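{- Let $G$ be a bipartite graph with sides $A$ and $B$, both infinite, such that $G$ is a dHp graph and every vertex of $A$ has finite degree in $G$. Suppose that for each $v\in B$, either $N(v)$ is finite or $N(v)=A\setminus F_v$ for some finite set $F_v\subset A$. Then there is a collection of pairwise vertex-disjoint 2-regular subgraphs of $G$ covering all the vertices of $A$.
   Context: For $X\subseteq V(G)$ with $|X|\ge 2$, $N^2_G(X)$ (or $N^2(X)$) denotes the set of vertices of $G$ having at least two neighbours in $X$. A bipartite graph $G$ with sides $A$ and $B$ is a dHp graph (satisfies the double Hall property) if $|A|\ge 2$ and $|N^2(X)|\ge |X|$ for every $X\subseteq A$ with $|X|\ge 2$. $N(v)$ denotes the set of neighbours of $v$. A 2-regular subgraph is a subgraph in which every vertex has degree exactly $2$ (its components are finite cycles or double rays, i.e. two-way infinite paths). A collection of subgraphs covers $A$ if every vertex of $A$ lies in one of them. -}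

module Defs where

open import Data.Empty using (⊥)
open import Data.Unit using (⊤)
open import Data.Product using (Σ; Σ-syntax; ∃; ∃-syntax; _×_; _,_; proj₁)
open import Data.Sum using (_⊎_)
open import Data.List using (List)
open import Data.List.Membership.Propositional using (_∈_; _∉_)
open import Relation.Nullary using (¬_; Dec)
open import Relation.Binary.PropositionalEquality using (_≡_; _≢_)
open import Function.Bundles using (_⇔_)

-- Classical logic (the paper works in ordinary classical mathematics).
ExcludedMiddle : Set₁
ExcludedMiddle = (P : Set) → Dec P

Subset : Set → Set₁
Subset V = V → Set

Finite : {V : Set} → Subset V → Set
Finite {V} X = Σ[ xs ∈ List V ] (∀ v → X v ⇔ (v ∈ xs))

Infinite : Set → Set
Infinite V = ¬ Finite {V} (λ _ → ⊤)

AtLeastTwo : {V : Set} → Subset V → Set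
AtLeastTwo {V} X = Σ[ x ∈ V ] Σ[ y ∈ V ] (x ≢ y × X x × X y)

_≼_ : {U V : Set} → Subset U → Subset V → Set
_≼_ {U} {V} X Y =
  Σ[ f ∈ (Σ U X → Σ V Y) ] (∀ p q → proj₁ (f p) ≡ proj₁ (f q) → proj₁ p ≡ proj₁ q)

module Bipartite {A B : Set} (E : A → B → Set) where

  NA : A → Subset B
  NA a b = E a b

  NB : B → Subset A
  NB b a = E a b

  N² : Subset A → Subset B
  N² X b = Σ[ a₁ ∈ A ] Σ[ a₂ ∈ A ] (a₁ ≢ a₂ × X a₁ × X a₂ × E a₁ b × E a₂ b)

  dHp : Set₁
  dHp = AtLeastTwo {A} (λ _ → ⊤)
      × ((X : Subset A) → AtLeastTwo X → X ≼ N² X)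

  record Subgraph : Set₁ where
    field
      VA : Subset A
      VB : Subset B
      EH : A → B → Set
      EH⊆E : ∀ a b → EH a b → E a b
      EH-endsA : ∀ a b → EH a b → VA a
      EH-endsB : ∀ a b → EH a b → VB b

  ExactlyTwo : {V : Set} → Subset V → Set
  ExactlyTwo {V} N =
    Σ[ x ∈ V ] Σ[ y ∈ V ] (x ≢ y × N x × N y × (∀ z → N z → z ≡ x ⊎ z ≡ y))

  TwoRegular : Subgraph → Set
  TwoRegular H = (∀ a → VA a → ExactlyTwo (λ b → EH a b))
               × (∀ b → VB b → ExactlyTwo (λ a → EH a b))
    where open Subgraph H

{-# OPTIONS --safe #-}
-- It suffices to find an edge set giving every vertex of A degree 2 and every vertex of B degree 0 or 2.
--
-- Finite case, by induction on |A|. Every A − x has such an edge set F_x; it uses only |A| − 1 vertices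
-- of B, so some β with two neighbours u ≠ v in A is unused. Push the two units of degree missing at x
-- towards the configuration F_u, each time correcting two edges at one vertex of B, so that the distance
-- to F_u drops. If this never touches β it ends in a solution, or with u missed and β unused; then add uβ
-- and push the remaining defect towards F_v. Once β has degree 1, the walk to F_u can only end in a
-- solution, since the last missing unit at u is supplied by the edge uβ (same for v).
--
-- Infinite case. Call b big if its neighbourhood is cofinite. Vertices of A pairwise without common
-- non-big neighbours have all their double neighbours big, so there are infinitely many big vertices;
-- as every a is adjacent to finitely many of them, A and the edge set are countable. Compactness gives
-- an edge set with all degrees right except that big vertices may have degree 1. These are repaired one
-- after another. A big b of degree 1 takes a far vertex z away from another big vertex c; if no such z
-- exists, then b takes z from a non-big c, whose other neighbour z′ is given to an unused big vertex u.
-- The new deficient vertex (c or u) is repaired later. Vertices of B already treated are never touched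
-- again, so, degrees in A being finite, the process converges.
module Submission where

open import Defs
open import Data.Bool using (Bool; true; false; not; _xor_)
open import Data.Empty using (⊥; ⊥-elim)
open import Data.Unit using (⊤; tt)
open import Data.Nat using (ℕ; zero; suc; _+_; _*_; _≤_; _<_; z≤n; s≤s; s≤s⁻¹; _⊔_)
open import Data.Nat.ListAction using (sum)
open import Data.Nat.Properties hiding (_≟_)
open import Algebra.Properties.CommutativeSemigroup +-commutativeSemigroup using (interchange; x∙yz≈y∙xz)
open import Data.Product using (Σ; Σ-syntax; ∃; ∃-syntax; _×_; _,_; proj₁; proj₂; uncurry)
open import Data.Sum using (_⊎_; inj₁; inj₂; [_,_]′)
open import Data.List using (List; []; _∷_; _++_; length; filter; map; concatMap; cartesianProduct; deduplicate)
open import Data.List.Properties using (filter-all; filter-accept; filter-reject)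
open import Data.List.Membership.Propositional using (_∈_; _∉_; lose)
open import Data.List.Membership.Propositional.Properties
  using (∈-++⁺ˡ; ∈-++⁺ʳ; ∈-map⁺; ∈-map⁻; ∈-filter⁺; ∈-filter⁻; ∈-concatMap⁺; ∈-cartesianProduct⁺; ∈-deduplicate⁺)
open import Data.List.Relation.Unary.Any using (here; there)
open import Data.List.Relation.Unary.All as All using ([]; _∷_)
open import Data.List.Relation.Unary.AllPairs using ([]; _∷_)
open import Data.List.Relation.Unary.Unique.Propositional using (Unique)
import Data.List.Relation.Unary.Unique.Propositional.Properties as Uniq
open import Data.List.Relation.Unary.Unique.DecPropositional.Properties using (deduplicate-!)
open import Function using (_∘_; case_of_; id)
open import Function.Bundles using (_⇔_; mk⇔; Equivalence)
open import Relation.Nullary using (¬_; Dec; yes; no; ¬?; contradiction)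
open import Relation.Unary using (_≐_)
open import Relation.Unary.Properties using (≐-refl; ≐-trans)
open import Relation.Binary.PropositionalEquality
  using (_≡_; _≢_; refl; sym; trans; cong; cong₂; subst; ≢-sym; module ≡-Reasoning)

open Equivalence using (to; from)

-- Counting in finite lists

bit : Bool → ℕ
bit true  = 1
bit false = 0

count : {V : Set} → List V → (V → Bool) → ℕ
count []       p = 0
count (x ∷ xs) p = bit (p x) + count xs p

module _ {V : Set} where

  head-∉ : ∀ {x : V} {xs} → Unique (x ∷ xs) → x ∉ xs
  head-∉ (x≢ ∷ _) x∈xs = All.lookup x≢ x∈xs refl

  count-cong : ∀ {p q : V → Bool} xs → (∀ {x} → x ∈ xs → p x ≡ q x) → count xs p ≡ count xs q
  count-cong []       eq = refl
  count-cong (x ∷ xs) eq = cong₂ _+_ (cong bit (eq (here refl))) (count-cong xs (eq ∘ there))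

  count-none : ∀ {p : V → Bool} xs → (∀ {x} → x ∈ xs → p x ≡ false) → count xs p ≡ 0
  count-none []       none = refl
  count-none (x ∷ xs) none rewrite none (here refl) = count-none xs (none ∘ there)

  none-of-count : ∀ {p : V → Bool} {xs x} → count xs p ≡ 0 → x ∈ xs → p x ≡ false
  none-of-count {p} {y ∷ ys} c≡0 x∈ with p y in eq
  none-of-count {p} {y ∷ ys} c≡0 (here refl) | false = eq
  none-of-count {p} {y ∷ ys} c≡0 (there x∈)  | false = none-of-count c≡0 x∈

  count-excess : ∀ {p q : V → Bool} xs → count xs p < count xs q →
                 ∃[ x ] (x ∈ xs × p x ≡ false × q x ≡ true)
  count-excess {p} {q} (x ∷ xs) c< with p x in px | q x in qx
  ... | false | true  = x , here refl , px , qx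
  ... | false | false = let (y , y∈ , r) = count-excess xs c< in y , there y∈ , r
  ... | true  | true  = let (y , y∈ , r) = count-excess xs (s≤s⁻¹ c<) in y , there y∈ , r
  ... | true  | false = let (y , y∈ , r) = count-excess xs (<⇒≤ c<) in y , there y∈ , r

  record DiffersAt (p q : V → Bool) (x : V) : Set where
    field
      at   : q x ≡ not (p x)
      else : ∀ {y} → y ≢ x → q y ≡ p y

  -- Writing the old bit on one side and the new bit on the other avoids subtraction; `count-up` and
  -- `count-down` are the two cases.
  count-differs : ∀ {p q : V → Bool} {x xs} → DiffersAt p q x → Unique xs → x ∈ xs →
                  bit (p x) + count xs q ≡ bit (not (p x)) + count xs p
  count-differs {p} {q} {x} {_ ∷ xs} d u@(_ ∷ _) (here refl) = begin
    bit (p x) + (bit (q x) + count xs q)       ≡⟨ cong₂ (λ i j → bit (p x) + (bit i + j)) at rest ⟩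
    bit (p x) + (bit (not (p x)) + count xs p) ≡⟨ x∙yz≈y∙xz (bit (p x)) (bit (not (p x))) (count xs p) ⟩
    bit (not (p x)) + (bit (p x) + count xs p) ∎
    where
    open ≡-Reasoning
    open DiffersAt d
    rest : count xs q ≡ count xs p
    rest = count-cong xs λ y∈ → else λ { refl → head-∉ u y∈ }
  count-differs {p} {q} {x} {y ∷ ys} d u@(_ ∷ uys) (there x∈) = begin
    bit (p x) + (bit (q y) + count ys q)       ≡⟨ cong (λ i → bit (p x) + (bit i + count ys q)) (DiffersAt.else d λ { refl → head-∉ u x∈ }) ⟩
    bit (p x) + (bit (p y) + count ys q)       ≡⟨ x∙yz≈y∙xz (bit (p x)) (bit (p y)) (count ys q) ⟩
    bit (p y) + (bit (p x) + count ys q)       ≡⟨ cong (bit (p y) +_) (count-differs d uys x∈) ⟩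
    bit (p y) + (bit (not (p x)) + count ys p) ≡⟨ x∙yz≈y∙xz (bit (p y)) (bit (not (p x))) (count ys p) ⟩
    bit (not (p x)) + (bit (p y) + count ys p) ∎
    where
    open ≡-Reasoning

  count-up : ∀ {p q : V → Bool} {x xs} → DiffersAt p q x → Unique xs → x ∈ xs →
             p x ≡ false → count xs q ≡ suc (count xs p)
  count-up {p} {q} {x} d u x∈ px with p x | count-differs d u x∈
  count-up d u x∈ refl | false | eq = eq

  count-down : ∀ {p q : V → Bool} {x xs} → DiffersAt p q x → Unique xs → x ∈ xs →
               p x ≡ true → suc (count xs q) ≡ count xs p
  count-down {p} {q} {x} d u x∈ px with p x | count-differs d u x∈
  count-down d u x∈ refl | true | eq = eq

  one-of-count : ∀ {p : V → Bool} {xs} → count xs p ≡ 1 →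
                 Σ[ x ∈ V ] ((x ∈ xs × p x ≡ true) × (∀ {z} → z ∈ xs → p z ≡ true → z ≡ x))
  one-of-count {p} {x ∷ xs} c≡1 with p x in eq
  ... | true  = x , (here refl , eq) , λ
    { (here refl) pz → refl
    ; (there z∈)  pz → contradiction (trans (sym pz) (none-of-count (suc-injective c≡1) z∈)) λ () }
  ... | false = let (y , (y∈ , py) , only) = one-of-count c≡1 in y , (there y∈ , py) , λ
    { (here refl) pz → contradiction (trans (sym pz) eq) λ ()
    ; (there z∈)  pz → only z∈ pz }

  two-of-count : ∀ {p : V → Bool} {xs} → Unique xs → count xs p ≡ 2 →
                 Σ[ x ∈ V ] Σ[ y ∈ V ] (x ≢ y × (x ∈ xs × p x ≡ true) × (y ∈ xs × p y ≡ true) ×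
                   (∀ {z} → z ∈ xs → p z ≡ true → z ≡ x ⊎ z ≡ y))
  two-of-count {p} {x ∷ xs} u@(_ ∷ uxs) c≡2 with p x in eq
  ... | true  = let (y , (y∈ , py) , only) = one-of-count (suc-injective c≡2) in
    x , y , (λ { refl → head-∉ u y∈ }) , (here refl , eq) , (there y∈ , py) , λ
      { (here refl) _ → inj₁ refl ; (there z∈) pz → inj₂ (only z∈ pz) }
  ... | false = let (y , y′ , y≢ , (y∈ , py) , (y′∈ , py′) , only) = two-of-count uxs c≡2 in
    y , y′ , y≢ , (there y∈ , py) , (there y′∈ , py′) , λ
      { (here refl) pz → contradiction (trans (sym pz) eq) λ ()
      ; (there z∈)  pz → only z∈ pz }

  count-true : ∀ (xs : List V) → count xs (λ _ → true) ≡ length xs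
  count-true []       = refl
  count-true (_ ∷ xs) = cong suc (count-true xs)

-- Double counting of the pairs in `F`; it compares the edges of a cover seen from `A` and from `B`.
sum-count-swap : ∀ {U V : Set} (F : U → V → Bool) us vs →
  sum (map (λ v → count us (λ u → F u v)) vs) ≡ sum (map (λ u → count vs (F u)) us)
sum-count-swap F []       vs = zeros vs
  where
  zeros : ∀ vs → sum (map (λ _ → 0) vs) ≡ 0
  zeros []       = refl
  zeros (_ ∷ vs) = zeros vs
sum-count-swap F (u ∷ us) vs = trans (split vs) (cong (count vs (F u) +_) (sum-count-swap F us vs))
  where
  open ≡-Reasoning
  col : _ → ℕ
  col v = count us (λ u → F u v)
  split : ∀ vs → sum (map (λ v → bit (F u v) + col v) vs) ≡ count vs (F u) + sum (map col vs)
  split []       = refl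
  split (v ∷ vs) = begin
    (bit (F u v) + col v) + sum (map (λ v → bit (F u v) + col v) vs) ≡⟨ cong ((bit (F u v) + col v) +_) (split vs) ⟩
    (bit (F u v) + col v) + (count vs (F u) + sum (map col vs))      ≡⟨ interchange (bit (F u v)) (col v) _ _ ⟩
    (bit (F u v) + count vs (F u)) + (col v + sum (map col vs))      ∎

sum-const : ∀ {V : Set} (f : V → ℕ) k vs → (∀ {v} → v ∈ vs → f v ≡ k) → sum (map f vs) ≡ length vs * k
sum-const f k []       eq = refl
sum-const f k (v ∷ vs) eq = cong₂ _+_ (eq (here refl)) (sum-const f k vs (eq ∘ there))

sum-mono : ∀ {V : Set} {f g : V → ℕ} vs → (∀ v → f v ≤ g v) → sum (map f vs) ≤ sum (map g vs)
sum-mono []       le = z≤n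
sum-mono (v ∷ vs) le = +-mono-≤ (le v) (sum-mono vs le)

module Classical (em : ExcludedMiddle) where

  infix 4 _≟_
  _≟_ : {V : Set} (x y : V) → Dec (x ≡ y)
  x ≟ y = em (x ≡ y)

  without : {V : Set} → V → List V → List V
  without x = filter (λ y → ¬? (y ≟ x))

  module _ {V : Set} where

    ∈-without⁺ : ∀ {x y : V} {xs} → y ∈ xs → y ≢ x → y ∈ without x xs
    ∈-without⁺ {x} = ∈-filter⁺ (λ y → ¬? (y ≟ x))

    ∈-without⁻ : ∀ {x y : V} {xs} → y ∈ without x xs → y ∈ xs × y ≢ x
    ∈-without⁻ {x} = ∈-filter⁻ (λ y → ¬? (y ≟ x))

    unique-without : ∀ {x : V} {xs} → Unique xs → Unique (without x xs)
    unique-without {x} = Uniq.filter⁺ (λ y → ¬? (y ≟ x))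

    count-without : ∀ {p : V → Bool} {x xs} → Unique xs → x ∈ xs →
                    count xs p ≡ bit (p x) + count (without x xs) p
    count-without {p} {x} {_ ∷ xs} (x≢ ∷ u) (here refl) = cong (λ l → bit (p x) + count l p) (sym (trans
      (filter-reject (λ y → ¬? (y ≟ x)) {x} {xs} (λ ne → ne refl))
      (filter-all (λ y → ¬? (y ≟ x)) (All.map ≢-sym x≢))))
    count-without {p} {x} {y ∷ ys} u@(_ ∷ uys) (there x∈) = begin
      bit (p y) + count ys p                              ≡⟨ cong (bit (p y) +_) (count-without uys x∈) ⟩
      bit (p y) + (bit (p x) + count (without x ys) p)    ≡⟨ x∙yz≈y∙xz (bit (p y)) (bit (p x)) (count (without x ys) p) ⟩
      bit (p x) + count (y ∷ without x ys) p              ≡⟨ cong (λ l → bit (p x) + count l p)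
        (filter-accept (λ z → ¬? (z ≟ x)) {y} {ys} (λ { refl → head-∉ u x∈ })) ⟨
      bit (p x) + count (without x (y ∷ ys)) p            ∎
      where open ≡-Reasoning

    length-without : ∀ {x : V} {xs} → Unique xs → x ∈ xs → length xs ≡ suc (length (without x xs))
    length-without {x} {xs} u x∈ = trans (sym (count-true xs))
      (trans (count-without u x∈) (cong suc (count-true (without x xs))))

    count-⊆ : ∀ {p : V → Bool} {ys xs} → Unique ys → Unique xs → (∀ {y} → y ∈ ys → y ∈ xs) →
              count ys p ≤ count xs p
    count-⊆ {p} {[]}     uys uxs sub = z≤n
    count-⊆ {p} {y ∷ ys} u@(_ ∷ uys) uxs sub = subst (_ ≤_) (sym (count-without uxs (sub (here refl))))
      (+-monoʳ-≤ (bit (p y)) (count-⊆ uys (unique-without uxs)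
        λ z∈ → ∈-without⁺ (sub (there z∈)) λ { refl → head-∉ u z∈ }))

    length-⊆ : ∀ {ys xs : List V} → Unique ys → Unique xs → (∀ {y} → y ∈ ys → y ∈ xs) →
               length ys ≤ length xs
    length-⊆ {ys} {xs} uys uxs sub =
      subst (_≤ length xs) (count-true ys) (subst (_ ≤_) (count-true xs) (count-⊆ uys uxs sub))

-- The finite case

TwoNeighboursIn : {A B : Set} → (A → B → Set) → List A → B → Set
TwoNeighboursIn {A} E Xs y = Σ[ a₁ ∈ A ] Σ[ a₂ ∈ A ] (a₁ ≢ a₂ × a₁ ∈ Xs × a₂ ∈ Xs × E a₁ y × E a₂ y)

module Finite (em : ExcludedMiddle) {A B : Set} (E : A → B → Set)
              (Bs : List B) (uB : Unique Bs) where

  open Classical em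

  EdgeSet : Set
  EdgeSet = A → B → Bool

  -- Adding and deleting an edge are one operation, so a correction towards a target has the same
  -- form in both cases.
  toggle : A → B → EdgeSet → EdgeSet
  toggle a b F a′ b′ with em (a′ ≡ a × b′ ≡ b)
  ... | yes _ = not (F a′ b′)
  ... | no  _ = F a′ b′

  toggle-at : ∀ a b F → toggle a b F a b ≡ not (F a b)
  toggle-at a b F with em (a ≡ a × b ≡ b)
  ... | yes _ = refl
  ... | no ¬p = contradiction (refl , refl) ¬p

  toggle-else : ∀ {a b F a′ b′} → ¬ (a′ ≡ a × b′ ≡ b) → toggle a b F a′ b′ ≡ F a′ b′
  toggle-else {a} {b} {F} {a′} {b′} ¬p with em (a′ ≡ a × b′ ≡ b)
  ... | yes p = contradiction p ¬p
  ... | no _  = refl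

  degA : EdgeSet → A → ℕ
  degA F a = count Bs (F a)

  Discrepant : EdgeSet → EdgeSet → A → B → Set
  Discrepant F T a b = (F a b ≡ false × T a b ≡ true) ⊎ (F a b ≡ true × T a b ≡ false)

  Adjacent : ℕ → ℕ → Set
  Adjacent m n = m ≡ suc n ⊎ suc m ≡ n

  -- The induction shrinks `As` and keeps `Bs`; hence `degA` lives outside this module, while `degB`
  -- depends on `As`.
  module On (As : List A) (uA : Unique As) where

    degB : EdgeSet → B → ℕ
    degB F b = count As (λ a → F a b)

    Valid : EdgeSet → Set
    Valid F = ∀ a b → F a b ≡ true → E a b × a ∈ As × b ∈ Bs

    Even : EdgeSet → B → Set
    Even F b = degB F b ≡ 0 ⊎ degB F b ≡ 2

    record Cover (F : EdgeSet) : Set where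
      field
        valid : Valid F
        rows  : ∀ {a} → a ∈ As → degA F a ≡ 2
        cols  : ∀ b → Even F b

    record CoverExcept (u : A) (F : EdgeSet) : Set where
      field
        valid  : Valid F
        rows   : ∀ {a} → a ∈ As → a ≢ u → degA F a ≡ 2
        missed : degA F u ≡ 0
        cols   : ∀ b → Even F b

    valid-toggle : ∀ {F a b} → Valid F → E a b → a ∈ As → b ∈ Bs → Valid (toggle a b F)
    valid-toggle {F} {a} {b} v e a∈ b∈ a′ b′ t with em (a′ ≡ a × b′ ≡ b)
    ... | yes (refl , refl) = e , a∈ , b∈
    ... | no _              = v a′ b′ t

    row-differs : ∀ a b F → DiffersAt (F a) (toggle a b F a) b
    row-differs a b F = record { at = toggle-at a b F ; else = λ ne → toggle-else (ne ∘ proj₂) }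

    col-differs : ∀ a b F → DiffersAt (λ x → F x b) (λ x → toggle a b F x b) a
    col-differs a b F = record { at = toggle-at a b F ; else = λ ne → toggle-else (ne ∘ proj₁) }

    row-up : ∀ {F a b} → b ∈ Bs → F a b ≡ false → degA (toggle a b F) a ≡ suc (degA F a)
    row-up {F} {a} {b} b∈ = count-up (row-differs a b F) uB b∈

    row-down : ∀ {F a b} → b ∈ Bs → F a b ≡ true → suc (degA (toggle a b F) a) ≡ degA F a
    row-down {F} {a} {b} b∈ = count-down (row-differs a b F) uB b∈

    row-else : ∀ {F a b x} → x ≢ a → degA (toggle a b F) x ≡ degA F x
    row-else ne = count-cong Bs λ _ → toggle-else (ne ∘ proj₁)

    col-up : ∀ {F a b} → a ∈ As → F a b ≡ false → degB (toggle a b F) b ≡ suc (degB F b)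
    col-up {F} {a} {b} a∈ = count-up (col-differs a b F) uA a∈

    col-down : ∀ {F a b} → a ∈ As → F a b ≡ true → suc (degB (toggle a b F) b) ≡ degB F b
    col-down {F} {a} {b} a∈ = count-down (col-differs a b F) uA a∈

    col-cong : ∀ {F G : EdgeSet} {b} → (∀ x → F x b ≡ G x b) → degB F b ≡ degB G b
    col-cong eq = count-cong As λ {x} _ → eq x

    even-cong : ∀ {F G : EdgeSet} {b} → (∀ x → F x b ≡ G x b) → Even G b → Even F b
    even-cong {F} {G} eq (inj₁ e) = inj₁ (trans (col-cong {F} {G} eq) e)
    even-cong {F} {G} eq (inj₂ e) = inj₂ (trans (col-cong {F} {G} eq) e)

    even-else : ∀ {F a b b′} → b′ ≢ b → Even F b′ → Even (toggle a b F) b′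
    even-else {F} {a} {b} ne = even-cong {toggle a b F} {F} λ _ → toggle-else (ne ∘ proj₂)

    even-nonzero : ∀ {F a b} → Even F b → a ∈ As → F a b ≡ true → degB F b ≡ 2
    even-nonzero (inj₂ e) _ _ = e
    even-nonzero (inj₁ e) a∈ t = contradiction (trans (sym t) (none-of-count e a∈)) λ ()

    unused : ∀ {F b} → Valid F → degB F b ≡ 0 → ∀ x → F x b ≡ false
    unused {F} {b} v e x with F x b in eq
    ... | false = refl
    ... | true  = trans (sym eq) (none-of-count e (proj₁ (proj₂ (v x b eq))))

    pairs : List (A × B)
    pairs = cartesianProduct As Bs

    -- Hamming distance on `As` × `Bs`, the measure by which the walks below terminate.
    dist : EdgeSet → EdgeSet → ℕ
    dist F T = count pairs (uncurry λ a b → F a b xor T a b)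

    dist-toggle : ∀ {F T a b} → a ∈ As → b ∈ Bs → Discrepant F T a b →
                  dist (toggle a b F) T < dist F T
    dist-toggle {F} {T} {a} {b} a∈ b∈ d =
      ≤-reflexive (count-down differs (Uniq.cartesianProduct⁺ uA uB) (∈-cartesianProduct⁺ a∈ b∈) (wrong d))
      where
      wrong : Discrepant F T a b → F a b xor T a b ≡ true
      wrong (inj₁ (f , t)) rewrite f | t = refl
      wrong (inj₂ (f , t)) rewrite f | t = refl
      not-xor : ∀ x y → not x xor y ≡ not (x xor y)
      not-xor true  true  = refl
      not-xor true  false = refl
      not-xor false _     = refl
      differs : DiffersAt (uncurry λ a b → F a b xor T a b) (uncurry λ a′ b′ → toggle a b F a′ b′ xor T a′ b′) (a , b)
      differs = record
        { at   = trans (cong (_xor T a b) (toggle-at a b F)) (not-xor (F a b) (T a b))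
        ; else = λ { {a′ , b′} ne → cong (_xor T a′ b′) (toggle-else {F = F} λ { (refl , refl) → ne refl }) }
        }

    -- The result of correcting the edges `ab` and `a′b`. The change at `a` is known from the
    -- discrepancy chosen there; at `a′` the sign depends on which second edge is found, so `row′`
    -- only says that the degree moves by one.
    record Pass (F T : EdgeSet) (a : A) (b : B) : Set where
      field
        F′     : EdgeSet
        a′     : A
        a′≢a   : a′ ≢ a
        a′∈    : a′ ∈ As
        valid  : Valid F′
        even   : Even F′ b
        cols   : ∀ {b′} → b′ ≢ b → ∀ x → F′ x b′ ≡ F x b′
        row    : degA F′ a ≡ degA (toggle a b F) a
        row′   : Adjacent (degA F′ a′) (degA F a′)
        rows   : ∀ {x} → x ≢ a → x ≢ a′ → degA F′ x ≡ degA F x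
        closer : dist F′ T < dist F T

    -- Correcting one edge at b makes its degree odd, so the target differs at b in a second edge,
    -- which can be chosen so that correcting it too makes the degree of b 0 or 2 again.
    pass : ∀ {F T a b} → Valid F → Valid T → Even F b → Even T b → a ∈ As → b ∈ Bs →
           Discrepant F T a b → Pass F T a b
    pass {F} {T} {a} {b} vF vT evF evT a∈ b∈ d = go d evF evT
      where
      F₁ : EdgeSet
      F₁ = toggle a b F

      eab : Discrepant F T a b → E a b
      eab (inj₁ (_ , t)) = proj₁ (vT a b t)
      eab (inj₂ (f , _)) = proj₁ (vF a b f)

      v₁ : Valid F₁
      v₁ = valid-toggle vF (eab d) a∈ b∈

      second : ∀ {a′} → a′ ≢ a → a′ ∈ As → Discrepant F₁ T a′ b → Even (toggle a′ b F₁) b → Pass F T a b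
      second {a′} ne a′∈ d′ ev = record
        { F′ = toggle a′ b F₁ ; a′ = a′ ; a′≢a = ne ; a′∈ = a′∈
        ; valid = valid-toggle v₁ (e′ d′) a′∈ b∈
        ; even = ev
        ; cols = λ ne _ → trans (toggle-else {F = F₁} (ne ∘ proj₂)) (toggle-else (ne ∘ proj₂))
        ; row = row-else (≢-sym ne)
        ; row′ = adj d′
        ; rows = λ x≢a x≢a′ → trans (row-else x≢a′) (row-else x≢a)
        ; closer = <-trans (dist-toggle {F = F₁} a′∈ b∈ d′) (dist-toggle {F = F} a∈ b∈ d)
        }
        where
        e′ : Discrepant F₁ T a′ b → E a′ b
        e′ (inj₁ (_ , t)) = proj₁ (vT a′ b t)
        e′ (inj₂ (f , _)) = proj₁ (v₁ a′ b f)
        adj : Discrepant F₁ T a′ b → Adjacent (degA (toggle a′ b F₁) a′) (degA F a′)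
        adj (inj₁ (f , _)) = inj₁ (trans (row-up b∈ f) (cong suc (row-else ne)))
        adj (inj₂ (f , _)) = inj₂ (trans (row-down b∈ f) (row-else ne))

      -- The first argument shows that the excess edge found is not `ab` itself; it serves the same
      -- end in `remove`.
      add : F₁ a b ≡ true ⊎ T a b ≡ false → degB F₁ b ≡ 1 → degB T b ≡ 2 → Pass F T a b
      add ab e₁ eT with count-excess As (subst (degB F₁ b <_) (sym eT) (≤-reflexive (cong suc e₁)))
      ... | a′ , a′∈ , f , t = second (λ { refl → clash ab }) a′∈ (inj₁ (f , t)) (inj₂ (trans (col-up a′∈ f) (cong suc e₁)))
        where
        clash : F₁ a′ b ≡ true ⊎ T a′ b ≡ false → ⊥
        clash (inj₁ f′) = contradiction (trans (sym f) f′) λ ()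
        clash (inj₂ t′) = contradiction (trans (sym t) t′) λ ()

      remove : F₁ a b ≡ false ⊎ T a b ≡ true → degB T b < degB F₁ b →
               degB F₁ b ≡ 1 ⊎ degB F₁ b ≡ 3 → Pass F T a b
      remove ab lt odd with count-excess As lt
      ... | a′ , a′∈ , t , f = second (λ { refl → clash ab }) a′∈ (inj₂ (f , t)) (ev odd)
        where
        clash : F₁ a′ b ≡ false ⊎ T a′ b ≡ true → ⊥
        clash (inj₁ f′) = contradiction (trans (sym f) f′) λ ()
        clash (inj₂ t′) = contradiction (trans (sym t) t′) λ ()
        ev : degB F₁ b ≡ 1 ⊎ degB F₁ b ≡ 3 → Even (toggle a′ b F₁) b
        ev (inj₁ e) = inj₁ (suc-injective (trans (col-down a′∈ f) e))
        ev (inj₂ e) = inj₂ (suc-injective (trans (col-down a′∈ f) e))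

      flipped : F₁ a b ≡ not (F a b)
      flipped = toggle-at a b F

      -- After the first correction `b` has degree 1 or 3. From 3 an edge is removed; from 1 the
      -- second correction leads to 0 or 2, whichever the target has at `b`.
      go : Discrepant F T a b → Even F b → Even T b → Pass F T a b
      go (inj₁ (f , t)) (inj₁ e) evT = add (inj₁ (trans flipped (cong not f)))
        (trans (col-up a∈ f) (cong suc e)) (even-nonzero {T} evT a∈ t)
      go (inj₁ (f , t)) (inj₂ e) evT = remove (inj₂ t)
        (subst (_< degB F₁ b) (sym (even-nonzero {T} evT a∈ t)) (≤-reflexive (sym three))) (inj₂ three)
        where
        three : degB F₁ b ≡ 3
        three = trans (col-up a∈ f) (cong suc e)
      go (inj₂ (f , t)) evF evT = [ zero-target , add (inj₂ t) one ]′ evT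
        where
        one : degB F₁ b ≡ 1
        one = suc-injective (trans (col-down a∈ f) (even-nonzero {F} evF a∈ f))
        zero-target : degB T b ≡ 0 → Pass F T a b
        zero-target e = remove (inj₁ (trans flipped (cong not f)))
          (subst (_< degB F₁ b) (sym e) (≤-reflexive (sym one))) (inj₁ one)

    -- Walks towards a target that misses one vertex

    module Augment {T : EdgeSet} {u : A} {β : B} (target : CoverExcept u T) (u∈ : u ∈ As)
                   (β∈ : β ∈ Bs) (uβ : E u β) where

      module T = CoverExcept target

      degT≤2 : ∀ {a} → a ∈ As → degA T a ≤ 2
      degT≤2 {a} a∈ with a ≟ u
      ... | yes refl = subst (_≤ 2) (sym T.missed) z≤n
      ... | no a≢u   = ≤-reflexive (T.rows a∈ a≢u)

      -- With `loss`, this always supplies a next correction at a defective vertex, except at `u`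
      -- when its degree is too small.
      gain : ∀ {F a} → a ∈ As → a ≢ u → degA F a < 2 → ∃[ b ] (b ∈ Bs × F a b ≡ false × T a b ≡ true)
      gain a∈ a≢u lt = count-excess Bs (subst (_ <_) (sym (T.rows a∈ a≢u)) lt)

      loss : ∀ {F a} → a ∈ As → 2 < degA F a → ∃[ b ] (b ∈ Bs × F a b ≡ true × T a b ≡ false)
      loss a∈ lt = let (b , b∈ , t , f) = count-excess Bs (≤-<-trans (degT≤2 a∈) lt) in b , b∈ , f , t

      OffByOne : EdgeSet → A → Set
      OffByOne F a = degA F a ≡ 1 ⊎ degA F a ≡ 3

      off : ∀ {m n} → Adjacent m n → n ≡ 2 → m ≡ 1 ⊎ m ≡ 3
      off (inj₁ e) refl = inj₂ e
      off (inj₂ e) refl = inj₁ (suc-injective e)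

      -- A single unit of defect sits at `a`, and `β` has degree 1. A pass away from `β` moves the
      -- unit and lowers the distance. A correction that falls on `β` repairs `a` and `β` at once,
      -- and if the unit is missing at `u`, the edge `uβ`, still absent because column `β` is never
      -- touched before the end, does the same.
      finish : ∀ n F a → dist F T < n → Valid F → (∀ {b} → b ≢ β → Even F b) → degB F β ≡ 1 →
               F u β ≡ false → a ∈ As → OffByOne F a → (∀ {x} → x ∈ As → x ≢ a → degA F x ≡ 2) →
               ∃ Cover
      finish (suc n) F a d< v ev one uβ∉ a∈ tok rows = go tok
        where
        close : E a β → degA (toggle a β F) a ≡ 2 → Even (toggle a β F) β → ∃ Cover
        close e row col = toggle a β F , record
          { valid = valid-toggle v e a∈ β∈
          ; rows = λ {x} x∈ → case x ≟ a of λ { (yes refl) → row ; (no ne) → trans (row-else ne) (rows x∈ ne) }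
          ; cols = λ b → case b ≟ β of λ { (yes refl) → col ; (no ne) → even-else {F} ne (ev ne) } }

        continue : ∀ {b} → b ∈ Bs → b ≢ β → Discrepant F T a b → degA (toggle a b F) a ≡ 2 → ∃ Cover
        continue {b} b∈ b≢β d row₂ = finish n F′ a′ (<-≤-trans closer (s≤s⁻¹ d<)) valid
          (λ {b′} b′≢β → case b′ ≟ b of λ { (yes refl) → even ; (no ne) → even-cong {F′} {F} (cols ne) (ev b′≢β) })
          (trans (col-cong {F′} {F} (cols (≢-sym b≢β))) one)
          (trans (cols (≢-sym b≢β) u) uβ∉)
          a′∈ (off row′ (rows a′∈ a′≢a))
          (λ {x} x∈ x≢a′ → case x ≟ a of λ { (yes refl) → trans row row₂
                                           ; (no x≢a) → trans (rows′ x≢a x≢a′) (rows x∈ x≢a) })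
          where open Pass (pass {F} {T} v T.valid (ev b≢β) (T.cols b) a∈ b∈ d) renaming (rows to rows′)

        go : OffByOne F a → ∃ Cover
        go (inj₁ e) with a ≟ u
        ... | yes refl = close uβ (trans (row-up β∈ uβ∉) (cong suc e))
                           (inj₂ (trans (col-up a∈ uβ∉) (cong suc one)))
        ... | no a≢u with gain {F} a∈ a≢u (≤-reflexive (cong suc e))
        ...   | b , b∈ , f , t with b ≟ β
        ...     | yes refl = close (proj₁ (T.valid a b t)) (trans (row-up b∈ f) (cong suc e))
                               (inj₂ (trans (col-up a∈ f) (cong suc one)))
        ...     | no b≢β   = continue b∈ b≢β (inj₁ (f , t)) (trans (row-up b∈ f) (cong suc e))
        go (inj₂ e) with loss {F} a∈ (≤-reflexive (sym e))
        ... | b , b∈ , f , t with b ≟ β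
        ...   | yes refl = close (proj₁ (v a b f)) (suc-injective (trans (row-down b∈ f) e))
                             (inj₁ (suc-injective (trans (col-down a∈ f) one)))
        ...   | no b≢β   = continue b∈ b≢β (inj₂ (f , t)) (suc-injective (trans (row-down b∈ f) e))

      -- The two units of defect that start at the missed vertex: both at one vertex and of equal
      -- sign, or at two different vertices.
      data Defects (F : EdgeSet) : Set where
        one : ∀ z → z ∈ As → degA F z ≡ 0 ⊎ degA F z ≡ 4 →
              (∀ {x} → x ∈ As → x ≢ z → degA F x ≡ 2) → Defects F
        two : ∀ p q → p ≢ q → p ∈ As → q ∈ As → OffByOne F p → OffByOne F q →
              (∀ {x} → x ∈ As → x ≢ p → x ≢ q → degA F x ≡ 2) → Defects F

      Outcome : Set
      Outcome = ∃ Cover ⊎ (∃[ F ] (CoverExcept u F × degB F β ≡ 0))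

      -- Each pass moves one unit of defect and lowers the distance to `T`. The walk ends when two
      -- units cancel, when the wanted edge lies at `β`, or when both units are missing at `u`.
      wander : ∀ n F → dist F T < n → Valid F → (∀ b → Even F b) → degB F β ≡ 0 → Defects F → Outcome
      wander (suc n) F d< v ev β0 = go
        where
        dist′< : ∀ {F′} → dist F′ T < dist F T → dist F′ T < n
        dist′< lt = <-≤-trans lt (s≤s⁻¹ d<)

        free : ∀ x → F x β ≡ false
        free = unused {F} v β0

        through : ∀ {a b} → a ∈ As → b ∈ Bs → Discrepant F T a b → Pass F T a b
        through {b = b} a∈ b∈ d = pass {F} {T} v T.valid (ev b) (T.cols b) a∈ b∈ d

        resume : ∀ {a b} → b ≢ β → (P : Pass F T a b) → Defects (Pass.F′ P) → Outcome
        resume {b = b} b≢β P = wander n F′ (dist′< {F′} closer) valid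
          (λ b′ → case b′ ≟ b of λ { (yes refl) → even ; (no ne) → even-cong {F′} {F} (cols ne) (ev b′) })
          (trans (col-cong {F′} {F} (cols (≢-sym b≢β))) β0)
          where open Pass P

        -- The wanted edge at `a` lies at `β`. It is added without a second correction, which leaves
        -- `β` with degree 1 and one unit of defect, as `finish` requires.
        enter : ∀ {a q} → a ∈ As → a ≢ u → T a β ≡ true → q ∈ As → OffByOne (toggle a β F) q →
                (∀ {x} → x ∈ As → x ≢ q → degA (toggle a β F) x ≡ 2) → Outcome
        enter {a} {q} a∈ a≢u t q∈ tok rows = inj₁ (finish n (toggle a β F) q
          (dist′< {toggle a β F} (dist-toggle {F} a∈ β∈ (inj₁ (free a , t))))
          (valid-toggle v (proj₁ (T.valid a β t)) a∈ β∈)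
          (λ {b} ne → even-else {F} ne (ev b))
          (trans (col-up a∈ (free a)) (cong suc β0))
          (trans (toggle-else {F = F} (≢-sym a≢u ∘ proj₁)) (free u))
          q∈ tok rows)

        lost≢β : ∀ {a b} → F a b ≡ true → b ≢ β
        lost≢β {a} f refl = contradiction (trans (sym f) (free a)) λ ()

        spread : ∀ {z b} → b ≢ β → (P : Pass F T z b) → z ∈ As → OffByOne (toggle z b F) z →
                 (∀ {x} → x ∈ As → x ≢ z → degA F x ≡ 2) → Outcome
        spread {z} b≢β P z∈ tok rows = resume b≢β P (two z a′ (≢-sym a′≢a) z∈ a′∈
          (subst (λ k → k ≡ 1 ⊎ k ≡ 3) (sym row) tok) (off row′ (rows a′∈ a′≢a))
          λ x∈ x≢z x≢a′ → trans (rows′ x≢z x≢a′) (rows x∈ x≢z))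
          where open Pass P renaming (rows to rows′)

        land : ∀ {p q b} → b ≢ β → (P : Pass F T p b) → p ∈ As → q ∈ As → p ≢ q →
               degA (toggle p b F) p ≡ 2 → OffByOne F q →
               (∀ {x} → x ∈ As → x ≢ p → x ≢ q → degA F x ≡ 2) → Outcome
        land {p} {q} {b} b≢β P p∈ q∈ p≢q p2 tokq rows with Pass.a′ P ≟ q
        ... | no a′≢q = resume b≢β P (two a′ q a′≢q a′∈ q∈ (off row′ (rows a′∈ a′≢a a′≢q))
                (subst (λ k → k ≡ 1 ⊎ k ≡ 3) (sym (rows′ (≢-sym p≢q) (≢-sym a′≢q))) tokq)
                λ {x} x∈ x≢a′ x≢q → case x ≟ p of λ { (yes refl) → trans row p2
                                                    ; (no x≢p) → trans (rows′ x≢p x≢a′) (rows x∈ x≢p x≢q) })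
          where open Pass P renaming (rows to rows′)
        ... | yes refl = meet tokq row′
          where
          open Pass P renaming (rows to rows′)
          others : ∀ {x} → x ∈ As → x ≢ q → degA F′ x ≡ 2
          others {x} x∈ x≢q with x ≟ p
          ... | yes refl = trans row p2
          ... | no x≢p   = trans (rows′ x≢p x≢q) (rows x∈ x≢p x≢q)
          solved : degA F′ q ≡ 2 → Outcome
          solved q2 = inj₁ (F′ , record
            { valid = valid
            ; rows = λ {x} x∈ → case x ≟ q of λ { (yes refl) → q2 ; (no x≢q) → others x∈ x≢q }
            ; cols = λ b′ → case b′ ≟ b of λ { (yes refl) → even ; (no ne) → even-cong {F′} {F} (cols ne) (ev b′) } })
          -- The arriving unit meets the one at `q`: opposite signs cancel and give a cover, equal
          -- signs give degree 0 or 4.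
          meet : OffByOne F q → Adjacent (degA F′ q) (degA F q) → Outcome
          meet (inj₁ e) (inj₁ s) = solved (trans s (cong suc e))
          meet (inj₁ e) (inj₂ s) = resume b≢β P (one q q∈ (inj₁ (suc-injective (trans s e))) others)
          meet (inj₂ e) (inj₁ s) = resume b≢β P (one q q∈ (inj₂ (trans s (cong suc e))) others)
          meet (inj₂ e) (inj₂ s) = solved (suc-injective (trans s e))

        move-short : ∀ p q → p ≢ u → p ≢ q → p ∈ As → q ∈ As → degA F p ≡ 1 → OffByOne F q →
                     (∀ {x} → x ∈ As → x ≢ p → x ≢ q → degA F x ≡ 2) → Outcome
        move-short p q p≢u p≢q p∈ q∈ e tokq rows with gain {F} p∈ p≢u (≤-reflexive (cong suc e))
        ... | b , b∈ , f , t with b ≟ β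
        ...   | no b≢β   = land b≢β (through p∈ b∈ (inj₁ (f , t))) p∈ q∈ p≢q (trans (row-up b∈ f) (cong suc e)) tokq rows
        ...   | yes refl = enter p∈ p≢u t q∈ (subst (λ k → k ≡ 1 ⊎ k ≡ 3) (sym (row-else (≢-sym p≢q))) tokq)
                λ {x} x∈ x≢q → case x ≟ p of λ { (yes refl) → trans (row-up b∈ f) (cong suc e)
                                               ; (no x≢p) → trans (row-else x≢p) (rows x∈ x≢p x≢q) }

        move-long : ∀ p q → p ≢ q → p ∈ As → q ∈ As → degA F p ≡ 3 → OffByOne F q →
                    (∀ {x} → x ∈ As → x ≢ p → x ≢ q → degA F x ≡ 2) → Outcome
        move-long p q p≢q p∈ q∈ e tokq rows with loss {F} p∈ (≤-reflexive (sym e))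
        ... | b , b∈ , f , t = land (lost≢β f) (through p∈ b∈ (inj₂ (f , t))) p∈ q∈ p≢q
                (suc-injective (trans (row-down b∈ f) e)) tokq rows

        go : Defects F → Outcome
        go (one z z∈ (inj₁ e) rows) with z ≟ u
        ... | yes refl = inj₂ (F , record { valid = v ; rows = rows ; missed = e ; cols = ev } , β0)
        ... | no z≢u with gain {F} z∈ z≢u (subst (_< 2) (sym e) (s≤s z≤n))
        ...   | b , b∈ , f , t with b ≟ β
        ...     | yes refl = enter z∈ z≢u t z∈ (inj₁ (trans (row-up b∈ f) (cong suc e)))
                               λ x∈ x≢z → trans (row-else x≢z) (rows x∈ x≢z)
        ...     | no b≢β = spread b≢β (through z∈ b∈ (inj₁ (f , t))) z∈ (inj₁ (trans (row-up b∈ f) (cong suc e))) rows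
        go (one z z∈ (inj₂ e) rows) with loss {F} z∈ (subst (2 <_) (sym e) (s≤s (s≤s (s≤s z≤n))))
        ... | b , b∈ , f , t = spread (lost≢β f) (through z∈ b∈ (inj₂ (f , t))) z∈
                (inj₂ (suc-injective (trans (row-down b∈ f) e))) rows
        go (two p q p≢q p∈ q∈ (inj₂ e) tokq rows) = move-long p q p≢q p∈ q∈ e tokq rows
        go (two p q p≢q p∈ q∈ tokp (inj₂ e) rows) =
          move-long q p (≢-sym p≢q) q∈ p∈ e tokp λ x∈ x≢q x≢p → rows x∈ x≢p x≢q
        -- Both vertices are short, and only `u` can be stuck; as `p ≢ q`, one of them can move.
        go (two p q p≢q p∈ q∈ (inj₁ e) (inj₁ e′) rows) with p ≟ u
        ... | no p≢u   = move-short p q p≢u p≢q p∈ q∈ e (inj₁ e′) rows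
        ... | yes refl = move-short q p (≢-sym p≢q) (≢-sym p≢q) q∈ p∈ e′ (inj₁ e) λ x∈ x≢q x≢p → rows x∈ x≢p x≢q

    augment : ∀ {F T T′ x u v β} → CoverExcept x F → CoverExcept u T → CoverExcept v T′ →
              x ∈ As → u ∈ As → v ∈ As → u ≢ v → E u β → E v β → β ∈ Bs → degB F β ≡ 0 → ∃ Cover
    augment {F} {T} {T′} {x} {u} {v} {β} CF CT CT′ x∈ u∈ v∈ u≢v uβ vβ β∈ β0 =
      [ (λ c → c) , last ]′ (Augment.wander CT u∈ β∈ uβ (suc (dist F T)) F ≤-refl CF.valid CF.cols β0
        (Augment.one x x∈ (inj₁ CF.missed) CF.rows))
      where
      module CF = CoverExcept CF
      last : ∃[ G ] (CoverExcept u G × degB G β ≡ 0) → ∃ Cover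
      last (G , CG , β0) = Augment.finish CT′ v∈ β∈ vβ (suc (dist G₁ T′)) G₁ u ≤-refl
        (valid-toggle CG.valid uβ u∈ β∈) (λ {b} ne → even-else {G} ne (CG.cols b))
        (trans (col-up u∈ (free u)) (cong suc β0))
        (trans (toggle-else {F = G} (≢-sym u≢v ∘ proj₁)) (free v))
        u∈ (inj₁ (trans (row-up β∈ (free u)) (cong suc CG.missed)))
        (λ x∈ x≢u → trans (row-else x≢u) (CG.rows x∈ x≢u))
        where
        module CG = CoverExcept CG
        G₁ : EdgeSet
        G₁ = toggle u β G
        free : ∀ x → G x β ≡ false
        free = unused {G} CG.valid β0

  -- Induction on the number of vertices of `A`

  open On

  except : ∀ {As uA u} (u∈ : u ∈ As) → ∃ (Cover (without u As) (unique-without uA)) → ∃ (CoverExcept As uA u)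
  except {As} {uA} {u} u∈ (F , C) = F , record
    { valid  = λ a b t → let (e , a∈ , b∈) = valid a b t in e , proj₁ (∈-without⁻ {xs = As} a∈) , b∈
    ; rows   = λ a∈ a≢u → rows (∈-without⁺ a∈ a≢u)
    ; missed = count-none Bs λ {b} _ → empty b
    ; cols   = λ b → subst (λ k → k ≡ 0 ⊎ k ≡ 2)
        (sym (trans (count-without uA u∈) (cong (λ i → bit i + count (without u As) (λ a → F a b)) (empty b)))) (cols b)
    }
    where
    open Cover C
    empty : ∀ b → F u b ≡ false
    empty b with F u b in eq
    ... | false = refl
    ... | true  = contradiction refl (proj₂ (∈-without⁻ {xs = As} (proj₁ (proj₂ (valid u b eq)))))

  unused-or-all-two : ∀ {As uA F} → (∀ b → Even As uA F b) → ∀ Ys →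
          (∃[ y ] (y ∈ Ys × degB As uA F y ≡ 0)) ⊎ (∀ {y} → y ∈ Ys → degB As uA F y ≡ 2)
  unused-or-all-two ev [] = inj₂ λ ()
  unused-or-all-two {As} {uA} {F} ev (y ∷ ys) with ev y | unused-or-all-two {As} {uA} {F} ev ys
  ... | inj₁ e | _ = inj₁ (y , here refl , e)
  ... | inj₂ e | inj₁ (y′ , y′∈ , e′) = inj₁ (y′ , there y′∈ , e′)
  ... | inj₂ e | inj₂ all = inj₂ λ { (here refl) → e ; (there y∈) → all y∈ }

  -- Otherwise every vertex of `Ys` has degree 2, and `Ys` receives 2|Ys| edges, more than the 2|As|
  -- edges of the cover.
  exists-unused : ∀ {As uA F} → Cover As uA F → ∀ {Ys} → Unique Ys → (∀ {y} → y ∈ Ys → y ∈ Bs) →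
                  length As < length Ys → ∃[ y ] (y ∈ Ys × degB As uA F y ≡ 0)
  exists-unused {As} {uA} {F} C {Ys} uY Y⊆ lt with unused-or-all-two {As} {uA} {F} (Cover.cols C) Ys
  ... | inj₁ r   = r
  ... | inj₂ all = contradiction lt (≤⇒≯ (*-cancelʳ-≤ (length Ys) (length As) 2 (begin
    length Ys * 2                                  ≡⟨ sum-const _ 2 Ys all ⟨
    sum (map (degB As uA F) Ys)                    ≡⟨ sum-count-swap F As Ys ⟩
    sum (map (λ a → count Ys (F a)) As)            ≤⟨ sum-mono As (λ a → count-⊆ uY uB Y⊆) ⟩
    sum (map (degA F) As)                          ≡⟨ sum-const _ 2 As (Cover.rows C) ⟩
    length As * 2                                  ∎)))
    where open ≤-Reasoning

  -- Base of the induction, which stops at two vertices because the double Hall property says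
  -- nothing about a single one.
  four-cycle : ∀ {a₁ a₂ y₁ y₂} (uA : Unique (a₁ ∷ a₂ ∷ [])) → y₁ ≢ y₂ → y₁ ∈ Bs → y₂ ∈ Bs →
               E a₁ y₁ → E a₁ y₂ → E a₂ y₁ → E a₂ y₂ → ∃ (Cover (a₁ ∷ a₂ ∷ []) uA)
  four-cycle {a₁} {a₂} {y₁} {y₂} uA@((a₁≢a₂ ∷ []) ∷ _) y₁≢y₂ y₁∈ y₂∈ e₁₁ e₁₂ e₂₁ e₂₂ = F₄ , record
    { valid = valid-toggle _ uA (valid-toggle _ uA (valid-toggle _ uA (valid-toggle _ uA (λ _ _ ()) e₁₁ a₁∈ y₁∈)
                e₁₂ a₁∈ y₂∈) e₂₁ a₂∈ y₁∈) e₂₂ a₂∈ y₂∈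
    ; rows = λ { (here refl)         → trans (row-else _ uA a₁≢a₂) (trans (row-else _ uA a₁≢a₂)
                                         (trans (row-up _ uA y₂∈ f₂) (cong suc (trans (row-up _ uA y₁∈ refl) (cong suc none)))))
               ; (there (here refl)) → trans (row-up _ uA y₂∈ f₄) (cong suc (trans (row-up _ uA y₁∈ f₃)
                                         (cong suc (trans (row-else _ uA (≢-sym a₁≢a₂)) (trans (row-else _ uA (≢-sym a₁≢a₂)) none))))) }
    ; cols = cols }
    where
    F₀ F₁ F₂ F₃ F₄ : EdgeSet
    F₀ = λ _ _ → false
    F₁ = toggle a₁ y₁ F₀
    F₂ = toggle a₁ y₂ F₁
    F₃ = toggle a₂ y₁ F₂
    F₄ = toggle a₂ y₂ F₃
    As = a₁ ∷ a₂ ∷ []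
    a₁∈ : a₁ ∈ As
    a₁∈ = here refl
    a₂∈ : a₂ ∈ As
    a₂∈ = there (here refl)
    none : count Bs (λ _ → false) ≡ 0
    none = count-none Bs λ _ → refl
    f₂ : F₁ a₁ y₂ ≡ false
    f₂ = toggle-else {F = F₀} (≢-sym y₁≢y₂ ∘ proj₂)
    f₃ : F₂ a₂ y₁ ≡ false
    f₃ = trans (toggle-else {F = F₁} (y₁≢y₂ ∘ proj₂)) (toggle-else {F = F₀} (≢-sym a₁≢a₂ ∘ proj₁))
    f₄ : F₃ a₂ y₂ ≡ false
    f₄ = trans (toggle-else {F = F₂} (≢-sym y₁≢y₂ ∘ proj₂)) (trans (toggle-else {F = F₁} (≢-sym a₁≢a₂ ∘ proj₁))
           (toggle-else {F = F₀} (≢-sym a₁≢a₂ ∘ proj₁)))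
    cols : ∀ b → Even As uA F₄ b
    cols b with b ≟ y₁ | b ≟ y₂
    ... | yes refl | yes refl = contradiction refl y₁≢y₂
    ... | yes refl | no b≢y₂  = even-else As uA {F₃} b≢y₂ (inj₂ (trans (col-up As uA a₂∈ f₃)
                                  (cong suc (trans (col-cong As uA {F₂} {F₁} λ _ → toggle-else {F = F₁} (y₁≢y₂ ∘ proj₂))
                                    (col-up As uA {F₀} a₁∈ refl)))))
    ... | no b≢y₁  | yes refl = inj₂ (trans (col-up As uA a₂∈ f₄) (cong suc
                                  (trans (col-cong As uA {F₃} {F₂} λ _ → toggle-else {F = F₂} (b≢y₁ ∘ proj₂))
                                    (trans (col-up As uA a₁∈ f₂) (cong suc
                                      (col-cong As uA {F₁} {F₀} λ _ → toggle-else {F = F₀} (b≢y₁ ∘ proj₂)))))))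
    ... | no b≢y₁  | no b≢y₂  = even-else As uA {F₃} b≢y₂ (even-else As uA {F₂} b≢y₁ (even-else As uA {F₁} b≢y₂
                                  (even-else As uA {F₀} b≢y₁ (inj₁ refl))))

  both-adjacent : ∀ {a₁ a₂ y} → TwoNeighboursIn E (a₁ ∷ a₂ ∷ []) y → E a₁ y × E a₂ y
  both-adjacent (_ , _ , ne , here refl , here refl , _) = contradiction refl ne
  both-adjacent (_ , _ , _ , here refl , there (here refl) , e₁ , e₂) = e₁ , e₂
  both-adjacent (_ , _ , _ , there (here refl) , here refl , e₂ , e₁) = e₁ , e₂
  both-adjacent (_ , _ , ne , there (here refl) , there (here refl) , _) = contradiction refl ne

  module _ (doubleHall : ∀ Xs → Unique Xs → 2 ≤ length Xs →
              Σ[ Ys ∈ List B ] (Unique Ys × length Ys ≡ length Xs × (∀ {y} → y ∈ Ys → TwoNeighboursIn E Xs y)))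
    where

    -- `doubleHall` speaks of all lists, so it passes to smaller `As` unchanged; only the inclusion
    -- of all neighbours in `Bs` has to be inherited.
    cover : ∀ n As (uA : Unique As) → length As ≡ 2 + n → (∀ {a b} → a ∈ As → E a b → b ∈ Bs) → ∃ (Cover As uA)
    cover zero (a₁ ∷ a₂ ∷ []) uA refl nbr with doubleHall (a₁ ∷ a₂ ∷ []) uA ≤-refl
    ... | y₁ ∷ y₂ ∷ [] , ((y₁≢y₂ ∷ []) ∷ _) , refl , N² =
      let (e₁₁ , e₂₁) = both-adjacent (N² (here refl))
          (e₁₂ , e₂₂) = both-adjacent (N² (there (here refl)))
      in four-cycle uA y₁≢y₂ (nbr (here refl) e₁₁) (nbr (here refl) e₁₂) e₁₁ e₁₂ e₂₁ e₂₂
    cover (suc n) As@(x ∷ _) uA len nbr with doubleHall As uA (subst (2 ≤_) (sym len) (s≤s (s≤s z≤n)))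
    ... | Ys , uY , lenY , N² =
      let (β , β∈Ys , β0) = exists-unused (proj₂ (smaller (here refl))) uY Y⊆
            (subst (suc (length (without x As)) ≤_) (sym lenY) (≤-reflexive (sym (length-without uA (here refl)))))
          (u , v , u≢v , u∈ , v∈ , uβ , vβ) = N² β∈Ys
      in augment As uA (proj₂ (missing (here refl))) (proj₂ (missing u∈)) (proj₂ (missing v∈)) (here refl) u∈ v∈ u≢v uβ vβ (Y⊆ β∈Ys)
           (count-none As λ {a} _ → unused (without x As) (unique-without uA) (Cover.valid (proj₂ (smaller (here refl)))) β0 a)
      where
      smaller : ∀ {u} → u ∈ As → ∃ (Cover (without u As) (unique-without uA))
      smaller {u} u∈ = cover n (without u As) (unique-without uA)
        (suc-injective (trans (sym (length-without uA u∈)) len)) (nbr ∘ proj₁ ∘ ∈-without⁻ {xs = As})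
      missing : ∀ {u} → u ∈ As → ∃ (CoverExcept As uA u)
      missing u∈ = except u∈ (smaller u∈)
      Y⊆ : ∀ {y} → y ∈ Ys → y ∈ Bs
      Y⊆ y∈ = let (_ , _ , _ , a∈ , _ , e , _) = N² y∈ in nbr a∈ e

-- Enumeration, small degrees and compactness

∈-bind : ∀ {V W : Set} {f : V → List W} {xs x y} → x ∈ xs → y ∈ f x → y ∈ concatMap f xs
∈-bind {f = f} x∈ y∈ = ∈-concatMap⁺ f (lose x∈ y∈)

∉-++ : ∀ {V : Set} {x : V} xs {ys} → x ∉ xs ++ ys → x ∉ xs × x ∉ ys
∉-++ xs x∉ = x∉ ∘ ∈-++⁺ˡ , x∉ ∘ ∈-++⁺ʳ xs

-- Used to find one stage at which finitely many edges have all been reached.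
bounded : ∀ {V : Set} {Q : V → ℕ → Set} xs → (∀ {x} → x ∈ xs → ∃ (Q x)) →
          Σ[ n ∈ ℕ ] (∀ {x} → x ∈ xs → ∃[ k ] (k < n × Q x k))
bounded []       h = 0 , λ ()
bounded (x ∷ xs) h =
  let (k , q) = h (here refl)
      (n , r) = bounded xs (h ∘ there)
  in suc k ⊔ n , λ { (here refl) → k , m≤m⊔n (suc k) n , q
                   ; (there x∈)  → let (j , j< , q′) = r x∈ in j , ≤-trans j< (m≤n⊔m (suc k) n) , q′ }

-- A buffer and the index of the next list. The step that fetches a list emits `default`, so empty
-- lists need no special treatment.
module Flatten {X : Set} (default : X) (ls : ℕ → List X) where

  next : List X × ℕ → List X × ℕ
  next ([]     , i) = ls i , suc i
  next (x ∷ xs , i) = xs , i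

  state : ℕ → List X × ℕ
  state zero    = [] , 0
  state (suc n) = next (state n)

  emit : List X × ℕ → X
  emit ([]    , _) = default
  emit (x ∷ _ , _) = x

  enum : ℕ → X
  enum = emit ∘ state

  emitted : ∀ {x xs i} n → state n ≡ (xs , i) → x ∈ xs → ∃[ m ] enum m ≡ x
  emitted n eq (here refl) = n , cong emit eq
  emitted n eq (there x∈)  = emitted (suc n) (cong next eq) x∈

  drain : ∀ xs {i} n → state n ≡ (xs , i) → ∃[ m ] state m ≡ ([] , i)
  drain []       n eq = n , eq
  drain (_ ∷ xs) n eq = drain xs (suc n) (cong next eq)

  reached : ∀ k → ∃[ n ] state n ≡ ([] , k)
  reached zero    = 0 , refl
  reached (suc k) = let (n , eq) = reached k in drain (ls k) (suc n) (cong next eq)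

  enum-onto : ∀ {x} k → x ∈ ls k → ∃[ m ] enum m ≡ x
  enum-onto k x∈ = let (n , eq) = reached k in emitted (suc n) (cong next eq) x∈

-- Degrees for relations whose columns come with no finite list to count along. As with `Even`,
-- `EvenDegree` means 0 or 2, not parity.
Zero One Two EvenDegree AtMostTwo : {V : Set} → Subset V → Set
Zero P       = ∀ x → ¬ P x
One {V} P    = Σ[ x ∈ V ] (P x × (∀ y → P y → y ≡ x))
Two {V} P    = Σ[ x ∈ V ] Σ[ y ∈ V ] (x ≢ y × P x × P y × (∀ z → P z → z ≡ x ⊎ z ≡ y))
EvenDegree P = Zero P ⊎ Two P
AtMostTwo P  = Zero P ⊎ One P ⊎ Two P

module _ {V : Set} where

  Zero-resp : ∀ {P Q : Subset V} → P ≐ Q → Zero P → Zero Q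
  Zero-resp (_ , Q⊆P) none x q = none x (Q⊆P q)

  Two-resp : ∀ {P Q : Subset V} → P ≐ Q → Two P → Two Q
  Two-resp (P⊆Q , Q⊆P) (x , y , x≢y , px , py , only) = x , y , x≢y , P⊆Q px , P⊆Q py , λ z q → only z (Q⊆P q)

  EvenDegree-resp : ∀ {P Q : Subset V} → P ≐ Q → EvenDegree P → EvenDegree Q
  EvenDegree-resp eq (inj₁ p) = inj₁ (Zero-resp eq p)
  EvenDegree-resp eq (inj₂ p) = inj₂ (Two-resp eq p)

  AtMostTwo-resp : ∀ {P Q : Subset V} → P ≐ Q → AtMostTwo P → AtMostTwo Q
  AtMostTwo-resp eq (inj₁ p) = inj₁ (Zero-resp eq p)
  AtMostTwo-resp (P⊆Q , Q⊆P) (inj₂ (inj₁ (x , px , only))) = inj₂ (inj₁ (x , P⊆Q px , λ y → only y ∘ Q⊆P))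
  AtMostTwo-resp eq (inj₂ (inj₂ p)) = inj₂ (inj₂ (Two-resp eq p))

  Added Removed : V → Subset V → Subset V → Set
  Added   x P Q = Q ≐ (λ y → y ≡ x ⊎ P y)
  Removed x P Q = Q ≐ (λ y → y ≢ x × P y)

  Zero-add : ∀ {P Q : Subset V} {x} → Added x P Q → Zero P → One Q
  Zero-add {x = x} (Q⊆ , ⊆Q) none = x , ⊆Q (inj₁ refl) , λ y q → [ id , (λ p → contradiction p (none y)) ]′ (Q⊆ q)

  One-add : ∀ {P Q : Subset V} {x} → Added x P Q → ¬ P x → One P → Two Q
  One-add {P} {x = x} (Q⊆ , ⊆Q) ¬px (y , py , only) =
    x , y , (λ { refl → ¬px py }) , ⊆Q (inj₁ refl) , ⊆Q (inj₂ py) ,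
    λ z q → [ inj₁ , inj₂ ∘ only z ]′ (Q⊆ q)

  One-remove : ∀ {P Q : Subset V} {x} → Removed x P Q → P x → One P → Zero Q
  One-remove (Q⊆ , _) px (_ , _ , only) z q = let (z≢x , pz) = Q⊆ q in z≢x (trans (only z pz) (sym (only _ px)))

  Two-other : ∀ {P : Subset V} {x} → Two P → P x → Σ[ y ∈ V ] (y ≢ x × P y × (∀ z → P z → z ≡ x ⊎ z ≡ y))
  Two-other {x = x} (y , y′ , y≢y′ , py , py′ , only) px with only x px
  ... | inj₁ refl = y′ , ≢-sym y≢y′ , py′ , only
  ... | inj₂ refl = y , y≢y′ , py , λ z pz → [ inj₂ , inj₁ ]′ (only z pz)

  Two-remove : ∀ {P Q : Subset V} {x} → Removed x P Q → P x → Two P → One Q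
  Two-remove (Q⊆ , ⊆Q) px two = let (y , y≢x , py , only) = Two-other two px in
    y , ⊆Q (y≢x , py) , λ z q → let (z≢x , pz) = Q⊆ q in [ (λ e → contradiction e z≢x) , id ]′ (only z pz)

  elements : ∀ {P : Subset V} → AtMostTwo P → List V
  elements (inj₁ _)                    = []
  elements (inj₂ (inj₁ (x , _)))       = x ∷ []
  elements (inj₂ (inj₂ (x , y , _)))   = x ∷ y ∷ []

  ∈-elements : ∀ {P : Subset V} (d : AtMostTwo P) {x} → P x → x ∈ elements d
  ∈-elements (inj₁ none) px = contradiction px (none _)
  ∈-elements (inj₂ (inj₁ (_ , _ , only))) px = here (only _ px)
  ∈-elements (inj₂ (inj₂ (_ , _ , _ , _ , _ , only))) px = [ here , there ∘ here ]′ (only _ px)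

module _ {A B : Set} where

  -- The edge `zc` is replaced by `zb`: the degree of `z` is kept, `c` loses one and `b` gains one.
  -- Every repair consists of one or two such moves.
  reroute : (A → B → Set) → A → B → B → A → B → Set
  reroute H z c b a y = (a ≡ z × y ≡ b) ⊎ (H a y × ¬ (a ≡ z × y ≡ c))

  module Reroute {H : A → B → Set} {z : A} {c b : B} (zc : H z c) (¬zb : ¬ H z b) where

    H′ : A → B → Set
    H′ = reroute H z c b

    b≢c : b ≢ c
    b≢c refl = ¬zb zc

    rows : (∀ a → Two (H a)) → ∀ a → (a ≡ z ⊎ a ≢ z) → Two (H′ a)
    rows two a (inj₂ a≢z) = Two-resp
      ((λ h → inj₂ (h , a≢z ∘ proj₁)) , λ { (inj₁ (e , _)) → contradiction e a≢z ; (inj₂ (h , _)) → h }) (two a)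
    rows two a (inj₁ refl) = One-add
      ((λ { (inj₁ (_ , e)) → inj₁ e ; (inj₂ (h , n)) → inj₂ ((λ e → n (refl , e)) , h) })
      , λ { (inj₁ e) → inj₁ (refl , e) ; (inj₂ (n , h)) → inj₂ (h , n ∘ proj₂) })
      (¬zb ∘ proj₂)
      (Two-remove {P = H z} {Q = λ y → y ≢ c × H z y} (id , id) zc (two z))

    col-lost : Removed z (λ a → H a c) (λ a → H′ a c)
    col-lost = (λ { (inj₁ (_ , e)) → contradiction (sym e) b≢c ; (inj₂ (h , n)) → (λ e → n (e , refl)) , h })
             , λ { (n , h) → inj₂ (h , n ∘ proj₁) }

    col-gained : Added z (λ a → H a b) (λ a → H′ a b)
    col-gained = (λ { (inj₁ (e , _)) → inj₁ e ; (inj₂ (h , _)) → inj₂ h })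
               , λ { (inj₁ e) → inj₁ (e , refl) ; (inj₂ h) → inj₂ (h , b≢c ∘ proj₂) }

    col-else : ∀ {y} → y ≢ b → y ≢ c → (λ a → H a y) ≐ (λ a → H′ a y)
    col-else y≢b y≢c = (λ h → inj₂ (h , y≢c ∘ proj₂)) , λ { (inj₁ (_ , e)) → contradiction e y≢b ; (inj₂ (h , _)) → h }

module Compactness (em : ExcludedMiddle) (f : ℕ → ℕ → Bool) where

  InfinitelyOften : (ℕ → Set) → Set
  InfinitelyOften P = ∀ n → ∃[ m ] (n ≤ m × P m)

  -- Pigeonhole: if from some index on no member of `P` has the value `false`, all later members
  -- have `true`, which is then taken infinitely often.
  refine : ∀ {P} → InfinitelyOften P → ∀ k → ∃[ i ] InfinitelyOften (λ m → P m × f m k ≡ i)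
  refine {P} inf k with em (InfinitelyOften (λ m → P m × f m k ≡ true))
  ... | yes often = true , often
  ... | no ¬often = false , λ n → case em (∃[ m ] (n ≤ m × P m × f m k ≡ false)) of λ
    { (yes r) → r
    ; (no ¬r) → contradiction (λ n′ → let (m , le , p) = inf (n ⊔ n′) in
        m , ≤-trans (m≤n⊔m n n′) le , p , is-true (λ e → ¬r (m , ≤-trans (m≤m⊔n n n′) le , p , e))) ¬often }
    where
    is-true : ∀ {i} → i ≢ false → i ≡ true
    is-true {true}  _ = refl
    is-true {false} n = contradiction refl n

  stage : ℕ → Σ (ℕ → Set) InfinitelyOften
  stage zero    = (λ _ → ⊤) , λ n → n , ≤-refl , tt
  stage (suc k) = let (P , inf) = stage k ; (i , inf′) = refine inf k in (λ m → P m × f m k ≡ i) , inf′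

  limit : ℕ → Bool
  limit k = proj₁ (refine (proj₂ (stage k)) k)

  stage-agrees : ∀ n {m} → proj₁ (stage n) m → ∀ {k} → k < n → f m k ≡ limit k
  stage-agrees (suc n) (p , e) {k} k< with m≤n⇒m<n∨m≡n (s≤s⁻¹ k<)
  ... | inj₁ k<n  = stage-agrees n p k<n
  ... | inj₂ refl = e

  -- Every initial segment of the limit occurs in the sequence. The bound `n ≤ m` matters because
  -- the `m`-th finite cover is only guaranteed to serve the vertices in `seen m`.
  limit-agrees : ∀ n → ∃[ m ] (n ≤ m × (∀ {k} → k < n → f m k ≡ limit k))
  limit-agrees n = let (m , le , p) = proj₂ (stage n) n in m , le , stage-agrees n p

-- The infinite case

module DoubleHall (em : ExcludedMiddle) {A B : Set} (E : A → B → Set) (infA : Infinite A)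
                  (dhp : Bipartite.dHp E) (finite : ∀ a → Finite (λ b → E a b))
                  (finite-or-cofinite : ∀ b → Finite (λ a → E a b) ⊎ Σ[ F ∈ List A ] (∀ a → E a b ⇔ (a ∉ F)))
  where

  open Classical em

  Big : B → Set
  Big b = Σ[ F ∈ List A ] (∀ a → E a b ⇔ (a ∉ F))

  NA : A → List B
  NA a = proj₁ (finite a)

  ∈-NA : ∀ {a b} → E a b → b ∈ NA a
  ∈-NA {a} {b} = to (proj₂ (finite a) b)

  NA-∈ : ∀ {a b} → b ∈ NA a → E a b
  NA-∈ {a} {b} = from (proj₂ (finite a) b)

  -- Junk value [] at the vertices of cofinite neighbourhood.
  NB : B → List A
  NB b = [ proj₁ , (λ _ → []) ]′ (finite-or-cofinite b)

  NB-∈ : ∀ {a b} → a ∈ NB b → E a b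
  NB-∈ {a} {b} a∈ with finite-or-cofinite b
  ... | inj₁ (_ , eq) = from (eq a) a∈

  ∈-NB : ∀ {a b} → ¬ Big b → E a b → a ∈ NB b
  ∈-NB {a} {b} ¬big e with finite-or-cofinite b
  ... | inj₁ (_ , eq) = to (eq a) e
  ... | inj₂ big      = contradiction big ¬big

  opaque

    freshA : ∀ xs → Σ[ a ∈ A ] a ∉ xs
    freshA xs with em (Σ[ a ∈ A ] a ∉ xs)
    ... | yes r = r
    ... | no ¬r = contradiction (xs , λ v → mk⇔ (λ _ → case em (v ∈ xs) of λ { (yes p) → p ; (no n) → contradiction (v , n) ¬r }) _) infA

  -- The injection behind `≼` acts on elements paired with proofs, so `f` takes membership proofs
  -- and injectivity is required across all of them.
  image : ∀ xs → Unique xs → (f : ∀ {x} → x ∈ xs → B) →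
          (∀ {x y} (p : x ∈ xs) (q : y ∈ xs) → f p ≡ f q → x ≡ y) →
          Σ[ ys ∈ List B ] (Unique ys × length ys ≡ length xs × (∀ {y} → y ∈ ys → Σ[ x ∈ A ] Σ[ p ∈ x ∈ xs ] y ≡ f p))
  image [] _ f inj = [] , [] , refl , λ ()
  image (x ∷ xs) u@(_ ∷ uxs) f inj =
    let (ys , uys , len , pre) = image xs uxs (f ∘ there) (λ p q → inj (there p) (there q))
        fresh : ∀ {y} → y ∈ ys → f (here refl) ≢ y
        fresh y∈ e = let (x′ , p , e′) = pre y∈ in
          head-∉ u (subst (_∈ xs) (sym (inj (here refl) (there p) (trans e e′))) p)
    in f (here refl) ∷ ys , All.tabulate fresh ∷ uys , cong suc len ,
       λ { (here refl) → x , here refl , refl ; (there y∈) → let (x′ , p , e) = pre y∈ in x′ , there p , e }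

  opaque

    doubleHall : ∀ Xs → Unique Xs → 2 ≤ length Xs →
                 Σ[ Ys ∈ List B ] (Unique Ys × length Ys ≡ length Xs × (∀ {y} → y ∈ Ys → TwoNeighboursIn E Xs y))
    doubleHall (x ∷ []) _ (s≤s ())
    doubleHall Xs@(x₁ ∷ x₂ ∷ _) u _ =
      let (f , inj) = proj₂ dhp (_∈ Xs) (x₁ , x₂ , (λ { refl → head-∉ u (here refl) }) , here refl , there (here refl))
          (Ys , uY , len , pre) = image Xs u (λ {x} p → proj₁ (f (x , p))) (λ p q → inj (_ , p) (_ , q))
      in Ys , uY , len , λ y∈ → let (x , p , e) = pre y∈ in subst (TwoNeighboursIn E Xs) (sym e) (proj₂ (f (x , p)))

  -- Big vertices and the enumeration of the edges

  scattered : ∀ n → Σ[ Xs ∈ List A ] (Unique Xs × length Xs ≡ n ×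
                (∀ {x y b} → x ≢ y → x ∈ Xs → y ∈ Xs → E x b → E y b → Big b))
  scattered zero    = [] , [] , refl , λ _ ()
  scattered (suc n) =
    let (Xs , u , len , sc) = scattered n
        -- A vertex outside this list shares only big neighbours with `Xs`. The list is finite since
        -- degrees in `A` and at non-big vertices are.
        (a , a∉) = freshA (Xs ++ concatMap (λ x → concatMap NB (NA x)) Xs)
        (a∉Xs , a∉near) = ∉-++ Xs a∉
        far : ∀ {x b} → x ∈ Xs → E x b → E a b → Big b
        far {x} {b} x∈ xb ab = case em (Big b) of λ
          { (yes big) → big
          ; (no ¬big) → contradiction (∈-bind x∈ (∈-bind (∈-NA xb) (∈-NB ¬big ab))) a∉near }
    in a ∷ Xs , All.tabulate (λ x∈ → λ { refl → a∉Xs x∈ }) ∷ u , cong suc len , λ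
      { x≢y (here refl) (here refl) _  _  → contradiction refl x≢y
      ; x≢y (here refl) (there y∈)  ab yb → far y∈ yb ab
      ; x≢y (there x∈)  (here refl) xb ab → far x∈ xb ab
      ; x≢y (there x∈)  (there y∈)  xb yb → sc x≢y x∈ y∈ xb yb }

  length≤ : ∀ {V : Set} {ys xs : List V} → Unique ys → (∀ {y} → y ∈ ys → y ∈ xs) → length ys ≤ length (deduplicate _≟_ xs)
  length≤ {xs = xs} u sub = length-⊆ u (deduplicate-! _≟_ xs) (∈-deduplicate⁺ _≟_ ∘ sub)

  opaque

    -- A large scattered set of A has all its double neighbours among the big vertices.
    freshBig : ∀ L → Σ[ b ∈ B ] (Big b × b ∉ L)
    freshBig L with em (Σ[ b ∈ B ] (Big b × b ∉ L))
    ... | yes r = r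
    ... | no ¬r =
      -- The 2 makes `Xs` large enough for the double Hall property and gives more double neighbours
      -- than `L` can hold.
      let (Xs , u , len , sc) = scattered (2 + length (deduplicate _≟_ L))
          (Ys , uY , lenY , N²) = doubleHall Xs u (subst (2 ≤_) (sym len) (s≤s (s≤s z≤n)))
          Y⊆L : ∀ {y} → y ∈ Ys → y ∈ L
          Y⊆L {y} y∈ = let (_ , _ , ne , x∈ , x′∈ , e , e′) = N² y∈ in
            case em (y ∈ L) of λ { (yes p) → p ; (no n) → contradiction (y , sc ne x∈ x′∈ e e′ , n) ¬r }
      in contradiction (length≤ uY Y⊆L) (<⇒≱ (subst (length (deduplicate _≟_ L) <_) (sym (trans lenY len)) (n≤1+n _)))

  bigs : ℕ → List B
  bigs zero    = []
  bigs (suc n) = proj₁ (freshBig (bigs n)) ∷ bigs n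

  bigs-unique : ∀ n → Unique (bigs n)
  bigs-unique zero    = []
  bigs-unique (suc n) = All.tabulate (λ y∈ → λ { refl → proj₂ (proj₂ (freshBig (bigs n))) y∈ }) ∷ bigs-unique n

  length-bigs : ∀ n → length (bigs n) ≡ n
  length-bigs zero    = refl
  length-bigs (suc n) = cong suc (length-bigs n)

  -- The finite exceptional list of the big vertex that `bigs (suc n)` adds.
  nonneighbours : ℕ → List A
  nonneighbours n = proj₁ (proj₁ (proj₂ (freshBig (bigs n))))

  -- A vertex of A of finite degree cannot be adjacent to infinitely many big vertices.
  nonneighbours-cover : ∀ a → ∃[ n ] a ∈ nonneighbours n
  nonneighbours-cover a with em (∃[ n ] a ∈ nonneighbours n)
  ... | yes r = r
  ... | no ¬r = contradiction (length≤ {xs = NA a} (bigs-unique N) (∈-NA ∘ adjacent N))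
                  (<⇒≱ (≤-reflexive (sym (length-bigs N))))
    where
    N = suc (length (deduplicate _≟_ (NA a)))
    adjacent : ∀ n {b} → b ∈ bigs n → E a b
    adjacent (suc n) (here refl) = from (proj₂ (proj₁ (proj₂ (freshBig (bigs n)))) a) (λ a∈ → ¬r (n , a∈))
    adjacent (suc n) (there b∈)  = adjacent n b∈

  a₀ a₁ : A
  a₀ = proj₁ (proj₁ dhp)
  a₁ = proj₁ (proj₂ (proj₁ dhp))

  a₀≢a₁ : a₀ ≢ a₁
  a₀≢a₁ = proj₁ (proj₂ (proj₂ (proj₁ dhp)))

  opaque

    -- A double neighbour of `a` and any other vertex is adjacent to `a`. Hence every vertex of `A`
    -- occurs in the edge enumeration.
    neighbour : ∀ a → ∃ (E a)
    neighbour a = go (freshA (a ∷ []))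
      where
      go : Σ[ a′ ∈ A ] a′ ∉ (a ∷ []) → ∃ (E a)
      go (a′ , a′∉) with doubleHall (a ∷ a′ ∷ []) (((λ { refl → a′∉ (here refl) }) ∷ []) ∷ [] ∷ []) ≤-refl
      ... | y ∷ _ , _ , _ , N² with N² (here refl)
      ...   | _ , _ , _ , here refl , _ , e , _ = y , e
      ...   | _ , _ , _ , there (here refl) , here refl , _ , e = y , e
      ...   | _ , _ , ne , there (here refl) , there (here refl) , _ = contradiction refl ne

  opaque

    -- `A` is the union of the lists `nonneighbours n`, and each of its vertices has finite degree.
    -- Edges may be repeated.
    edges : Σ[ edge ∈ (ℕ → A × B) ] (∀ {a b} → E a b → ∃[ k ] edge k ≡ (a , b))
    edges = enum , λ {a} e → let (n , a∈) = nonneighbours-cover a in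
      enum-onto n (∈-bind a∈ (∈-map⁺ (a ,_) (∈-NA e)))
      where
      open Flatten (a₀ , proj₁ (neighbour a₀)) (λ n → concatMap (λ a → map (a ,_) (NA a)) (nonneighbours n))

  edge : ℕ → A × B
  edge = proj₁ edges

  edge-onto : ∀ {a b} → E a b → ∃[ k ] edge k ≡ (a , b)
  edge-onto = proj₂ edges

  -- The limit of the finite covers

  record FiniteCover (S : List A) (F : A → B → Bool) : Set where
    field
      sub  : ∀ {a b} → F a b ≡ true → E a b
      rows : ∀ {a} → a ∈ S → Two (λ b → F a b ≡ true)
      cols : ∀ b → EvenDegree (λ a → F a b ≡ true)

  opaque

    finiteCover : ∀ S → ∃ (FiniteCover S)
    finiteCover S = F , record
      { sub  = λ t → proj₁ (valid _ _ t)
      ; rows = λ a∈ → let (b , b′ , ne , (_ , t) , (_ , t′) , only) = two-of-count uB (rows (∈-deduplicate⁺ _≟_ (there (there a∈))))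
                      in b , b′ , ne , t , t′ , λ z tz → only (proj₂ (proj₂ (valid _ z tz))) tz
      ; cols = λ b → case cols b of λ
          { (inj₁ e) → inj₁ λ a t → contradiction (trans (sym t) (none-of-count e (proj₁ (proj₂ (valid a b t))))) λ ()
          ; (inj₂ e) → let (a , a′ , ne , (_ , t) , (_ , t′) , only) = two-of-count uA e
                       in inj₂ (a , a′ , ne , t , t′ , λ z tz → only (proj₁ (proj₂ (valid z b tz))) tz) } }
      where
      As : List A
      -- Two fixed vertices are added because `cover` needs at least two, and `S` may have fewer.
      As = deduplicate _≟_ (a₀ ∷ a₁ ∷ S)
      uA : Unique As
      uA = deduplicate-! _≟_ (a₀ ∷ a₁ ∷ S)
      Bs : List B
      Bs = deduplicate _≟_ (concatMap NA As)
      uB : Unique Bs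
      uB = deduplicate-! _≟_ (concatMap NA As)
      2≤ : 2 ≤ length As
      2≤ = length-⊆ {ys = a₀ ∷ a₁ ∷ []} ((a₀≢a₁ ∷ []) ∷ [] ∷ []) uA λ
        { (here refl)         → ∈-deduplicate⁺ _≟_ {xs = a₀ ∷ a₁ ∷ S} (here refl)
        ; (there (here refl)) → ∈-deduplicate⁺ _≟_ {xs = a₀ ∷ a₁ ∷ S} (there (here refl)) }
      module Fin = Finite em E Bs uB
      found : ∃ (Fin.On.Cover As uA)
      found = let (n , e) = m≤n⇒∃[o]m+o≡n 2≤ in
        Fin.cover doubleHall n As uA (sym e) λ a∈ e → ∈-deduplicate⁺ _≟_ (∈-bind a∈ (∈-NA e))
      F : A → B → Bool
      F = proj₁ found
      open Fin.On.Cover (proj₂ found)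

  seen : ℕ → List A
  seen zero    = []
  seen (suc n) = proj₁ (edge n) ∷ seen n

  ∈-seen : ∀ {k n} → k < n → proj₁ (edge k) ∈ seen n
  ∈-seen {k} {suc n} k< with m≤n⇒m<n∨m≡n (s≤s⁻¹ k<)
  ... | inj₁ k<n  = there (∈-seen k<n)
  ... | inj₂ refl = here refl

  approx : ℕ → A → B → Bool
  approx n = proj₁ (finiteCover (seen n))

  module Approx n = FiniteCover (proj₂ (finiteCover (seen n)))

  open Compactness em (λ n k → uncurry (approx n) (edge k)) using (limit; limit-agrees)

  Limit : A → B → Set
  Limit a b = ∃[ k ] (edge k ≡ (a , b) × limit k ≡ true)

  -- Some finite cover agrees with the limit at both indices, and it gives an edge one value.
  limit-unique : ∀ {j k} → edge j ≡ edge k → limit j ≡ limit k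
  limit-unique {j} {k} eq = let (m , _ , agree) = limit-agrees (suc (j ⊔ k)) in
    trans (sym (agree (s≤s (m≤m⊔n j k)))) (trans (cong (uncurry (approx m)) eq) (agree (s≤s (m≤n⊔m j k))))

  Agrees : ℕ → A → B → Set
  Agrees m a b = a ∈ seen m × (Limit a b → approx m a b ≡ true) × (approx m a b ≡ true → Limit a b)

  opaque

    -- On finitely many edges the limit equals one finite cover that also serves their ends in `A`;
    -- every property decided by finitely many edges therefore passes to the limit.
    Limit-local : ∀ ps → (∀ {a b} → (a , b) ∈ ps → E a b) →
                  ∃[ m ] (∀ {a b} → (a , b) ∈ ps → Agrees m a b)
    Limit-local ps ps⊆E =
      let (n , index) = bounded {Q = λ p k → edge k ≡ p} ps (λ p∈ → edge-onto (ps⊆E p∈))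
          (m , n≤m , agree) = limit-agrees n
      in m , λ p∈ → let (k , k<n , e) = index p∈
                        ak = trans (sym (cong (uncurry (approx m)) e)) (agree k<n) in
        subst (_∈ seen m) (cong proj₁ e) (∈-seen (≤-trans k<n n≤m)) ,
        (λ { (j , e′ , t) → trans ak (trans (limit-unique (trans e (sym e′))) t) }) ,
        λ t → k , e , trans (sym ak) t

  opaque

    Limit⊆E : ∀ {a b} → Limit a b → E a b
    Limit⊆E {a} {b} (k , e , t) = let (m , _ , agree) = limit-agrees (suc k) in
      Approx.sub m (trans (sym (cong (uncurry (approx m)) e)) (trans (agree ≤-refl) t))

  -- What survives the limit. Rows and non-big columns involve finitely many edges and keep their
  -- degrees; a big column may lose an edge to infinity, but three edges in it would already show in
  -- one finite cover.
  record Good (H : A → B → Set) : Set where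
    field
      sub   : ∀ {a b} → H a b → E a b
      rows  : ∀ a → Two (H a)
      small : ∀ {b} → ¬ Big b → EvenDegree (λ a → H a b)
      cols  : ∀ b → AtMostTwo (λ a → H a b)

  opaque

    Limit-good : Good Limit
    Limit-good = record { sub = Limit⊆E ; rows = rows ; small = small ; cols = cols }
      where
      rows : ∀ a → Two (Limit a)
      rows a with Limit-local (map (a ,_) (NA a)) (λ p∈ → case ∈-map⁻ (a ,_) p∈ of λ { (_ , b∈ , refl) → NA-∈ b∈ })
      ... | m , loc = Two-resp ((λ t → proj₂ (proj₂ (at (Approx.sub m t))) t) , λ h → proj₁ (proj₂ (at (Limit⊆E h))) h)
                        (Approx.rows m (proj₁ (at (proj₂ (neighbour a)))))
        where
        at : ∀ {b} → E a b → Agrees m a b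
        at e = loc (∈-map⁺ (a ,_) (∈-NA e))

      small : ∀ {b} → ¬ Big b → EvenDegree (λ a → Limit a b)
      small {b} ¬big with Limit-local (map (_, b) (NB b)) (λ p∈ → case ∈-map⁻ (_, b) p∈ of λ { (_ , a∈ , refl) → NB-∈ a∈ })
      ... | m , loc = EvenDegree-resp ((λ t → proj₂ (proj₂ (at (Approx.sub m t))) t) , λ h → proj₁ (proj₂ (at (Limit⊆E h))) h)
                        (Approx.cols m b)
        where
        at : ∀ {a} → E a b → Agrees m a b
        at e = loc (∈-map⁺ (_, b) (∈-NB ¬big e))

      no-three : ∀ {b x y z} → x ≢ y → z ≢ x → z ≢ y → Limit x b → Limit y b → Limit z b → ⊥
      no-three {b} {x} {y} {z} x≢y z≢x z≢y hx hy hz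
        with Limit-local ((x , b) ∷ (y , b) ∷ (z , b) ∷ [])
               (λ { (here refl) → Limit⊆E hx ; (there (here refl)) → Limit⊆E hy ; (there (there (here refl))) → Limit⊆E hz })
      ... | m , loc = go (proj₁ (proj₂ (loc (here refl))) hx) (proj₁ (proj₂ (loc (there (here refl)))) hy)
                         (proj₁ (proj₂ (loc (there (there (here refl))))) hz) (Approx.cols m b)
        where
        go : ∀ {P : Subset A} → P x → P y → P z → EvenDegree P → ⊥
        go px _  _  (inj₁ none) = none x px
        go {P} px py pz (inj₂ two) with Two-other {P = P} two px
        ... | w , _ , _ , only with only y py
        ...   | inj₁ e    = x≢y (sym e)
        ...   | inj₂ refl = [ z≢x , z≢y ]′ (only z pz)

      cols : ∀ b → AtMostTwo (λ a → Limit a b)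
      cols b with em (∃[ x ] Limit x b)
      ... | no none = inj₁ λ x h → none (x , h)
      ... | yes (x , hx) with em (∃[ y ] (y ≢ x × Limit y b))
      ...   | no single = inj₂ (inj₁ (x , hx , λ y hy → case y ≟ x of λ { (yes e) → e ; (no n) → contradiction (y , n , hy) single }))
      ...   | yes (y , y≢x , hy) = inj₂ (inj₂ (x , y , ≢-sym y≢x , hx , hy , λ z hz → case z ≟ x of λ
                { (yes e) → inj₁ e
                ; (no z≢x) → case z ≟ y of λ { (yes e) → inj₂ e ; (no z≢y) → ⊥-elim (no-three (≢-sym y≢x) z≢x z≢y hx hy hz) } }))

  -- Repairing a big vertex of degree 1

  record Repair (H : A → B → Set) (L : List B) (b : B) : Set₁ where
    field
      H′    : A → B → Set
      good  : Good H′
      fixed : EvenDegree (λ a → H′ a b)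
      keeps : ∀ {y} → y ∈ L → (λ a → H a y) ≐ (λ a → H′ a y)

  module _ {H : A → B → Set} (good : Good H) (L : List B) (b : B) (b∉L : b ∉ L)
           (big : Big b) {x : A} (xb : H x b) (only-x : ∀ y → H y b → y ≡ x) where

    open Good good

    near : List A
    near = x ∷ proj₁ big

    far-E : ∀ {a} → a ∉ near → E a b
    far-E {a} a∉ = from (proj₂ big a) (a∉ ∘ there)

    far-¬H : ∀ {a} → a ∉ near → ¬ H a b
    far-¬H {a} a∉ h = a∉ (here (only-x a h))

    col-b : One (λ a → H a b)
    col-b = x , xb , only-x

    -- Being far, `z` is adjacent to `b` but not yet joined to it by `H`. The vertex `c` may drop to
    -- degree 1, which `Good` allows since it is big; it is not in `L`, so treated columns stay
    -- intact.
    steal : ∀ {z c} → z ∉ near → Big c → c ∉ b ∷ L → H z c → Repair H L b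
    steal {z} {c} z∉ bigc c∉ zc = record
      { H′ = R.H′
      ; good = record
        { sub   = λ { (inj₁ (refl , refl)) → far-E z∉ ; (inj₂ (h , _)) → sub h }
        ; rows  = λ a → R.rows rows a (case a ≟ z of λ { (yes e) → inj₁ e ; (no n) → inj₂ n })
        ; small = λ {y} ¬big → EvenDegree-resp (R.col-else (λ { refl → ¬big big }) (λ { refl → ¬big bigc })) (small ¬big)
        ; cols  = cols′ }
      ; fixed = inj₂ two-b
      ; keeps = λ y∈ → R.col-else (λ { refl → b∉L y∈ }) (λ { refl → c∉ (there y∈) }) }
      where
      module R = Reroute {H = H} {z} {c} {b} zc (far-¬H z∉)
      two-b : Two (λ a → R.H′ a b)
      two-b = One-add R.col-gained (far-¬H z∉) col-b
      cols′ : ∀ y → AtMostTwo (λ a → R.H′ a y)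
      cols′ y with y ≟ b | y ≟ c
      ... | yes refl | _ = inj₂ (inj₂ two-b)
      ... | no y≢b | no y≢c = AtMostTwo-resp (R.col-else y≢b y≢c) (cols y)
      ... | no _ | yes refl with cols y
      ...   | inj₁ none = contradiction zc (none z)
      ...   | inj₂ (inj₁ one) = inj₁ (One-remove R.col-lost zc one)
      ...   | inj₂ (inj₂ two) = inj₂ (inj₁ (Two-remove R.col-lost zc two))

    -- A non-big `c` may not keep degree 1, so it gives up both edges: `z` goes to `b` and `z′` to
    -- `u`. Then `c` has degree 0, and the new vertex of degree 1 is the big `u`.
    replace : ∀ {z z′ c u} → z ∉ near → ¬ Big c → c ∉ b ∷ L → H z c → H z′ c → z′ ≢ z →
              Big u → u ∉ b ∷ L → Zero (λ a → H a u) → E z′ u → Repair H L b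
    replace {z} {z′} {c} {u} z∉ ¬bigc c∉ zc z′c z′≢z bigu u∉ zero-u z′u = record
      { H′ = R₂.H′
      ; good = record
        { sub   = λ { (inj₁ (refl , refl)) → z′u
                    ; (inj₂ (inj₁ (refl , refl) , _)) → far-E z∉
                    ; (inj₂ (inj₂ (h , _) , _)) → sub h }
        ; rows  = λ a → R₂.rows (λ a → R₁.rows rows a (case a ≟ z of λ { (yes e) → inj₁ e ; (no n) → inj₂ n }))
                    a (case a ≟ z′ of λ { (yes e) → inj₁ e ; (no n) → inj₂ n })
        ; small = small′
        ; cols  = cols′ }
      ; fixed = inj₂ two-b
      ; keeps = λ y∈ → col-else (λ { refl → b∉L y∈ }) (λ { refl → c∉ (there y∈) }) (λ { refl → u∉ (there y∈) }) }
      where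
      u≢b : u ≢ b
      u≢b refl = u∉ (here refl)
      u≢c : u ≢ c
      u≢c refl = ¬bigc bigu
      b≢c : b ≢ c
      b≢c refl = ¬bigc big
      module R₁ = Reroute {H = H} {z} {c} {b} zc (far-¬H z∉)
      z′c₁ : R₁.H′ z′ c
      z′c₁ = inj₂ (z′c , z′≢z ∘ proj₁)
      zero-u₁ : Zero (λ a → R₁.H′ a u)
      zero-u₁ = Zero-resp (R₁.col-else u≢b u≢c) zero-u
      module R₂ = Reroute {H = R₁.H′} {z′} {c} {u} z′c₁ (zero-u₁ z′)
      col-else : ∀ {y} → y ≢ b → y ≢ c → y ≢ u → (λ a → H a y) ≐ (λ a → R₂.H′ a y)
      col-else y≢b y≢c y≢u = ≐-trans (R₁.col-else y≢b y≢c) (R₂.col-else y≢u y≢c)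
      two-b : Two (λ a → R₂.H′ a b)
      two-b = Two-resp (R₂.col-else (≢-sym u≢b) b≢c) (One-add R₁.col-gained (far-¬H z∉) col-b)
      two-c : Two (λ a → H a c)
      two-c = [ (λ none → contradiction zc (none z)) , id ]′ (small ¬bigc)
      zero-c : Zero (λ a → R₂.H′ a c)
      zero-c = One-remove R₂.col-lost z′c₁ (Two-remove R₁.col-lost zc two-c)
      small′ : ∀ {y} → ¬ Big y → EvenDegree (λ a → R₂.H′ a y)
      small′ {y} ¬big with y ≟ c
      ... | yes refl = inj₁ zero-c
      ... | no y≢c = EvenDegree-resp (col-else (λ { refl → ¬big big }) y≢c (λ { refl → ¬big bigu })) (small ¬big)
      cols′ : ∀ y → AtMostTwo (λ a → R₂.H′ a y)
      cols′ y with y ≟ b | y ≟ c | y ≟ u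
      ... | yes refl | _ | _ = inj₂ (inj₂ two-b)
      ... | no _ | yes refl | _ = inj₁ zero-c
      ... | no _ | no _ | yes refl = inj₂ (inj₁ (Zero-add R₂.col-gained zero-u₁))
      ... | no y≢b | no y≢c | no y≢u = AtMostTwo-resp (col-else y≢b y≢c y≢u) (cols y)

    column : B → List A
    column y = elements (cols y)

    repair-one : Repair H L b
    repair-one with em (Σ[ z ∈ A ] Σ[ c ∈ B ] (z ∉ near × Big c × c ∉ b ∷ L × H z c))
    ... | yes (z , c , z∉ , bigc , c∉ , zc) = steal z∉ bigc c∉ zc
    ... | no ¬steal =
      -- No vertex of `near` is adjacent to `u`, so an `H`-edge at `u` would come from a far vertex
      -- and could be stolen; hence `u` has degree 0.
      let (u , bigu , u∉) = freshBig ((b ∷ L) ++ concatMap NA near)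
          (u∉L , u∉near) = ∉-++ (b ∷ L) u∉
          zero-u : Zero (λ a → H a u)
          zero-u a h = case em (a ∈ near) of λ
            { (yes a∈) → u∉near (∈-bind a∈ (∈-NA (sub h)))
            ; (no a∉)  → ¬steal (a , u , a∉ , bigu , u∉L , h) }
          avoid = near ++ proj₁ bigu
          -- The first list makes `z` far from `b`; the second puts its `H`-neighbour `c` outside
          -- `b ∷ L`; the third keeps the other vertex `z′` at `c` out of `avoid`, so `z′` is
          -- adjacent to `u`. All are finite since columns have at most two edges.
          (z , z∉) = freshA (near ++ concatMap column (b ∷ L) ++ concatMap (λ a → concatMap column (NA a)) avoid)
          (z∉near , z∉′) = ∉-++ near z∉
          (z∉cols , z∉partners) = ∉-++ (concatMap column (b ∷ L)) z∉′
          (c , _ , _ , zc , _) = rows z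
          c∉ : c ∉ b ∷ L
          c∉ c∈ = z∉cols (∈-bind c∈ (∈-elements (cols c) zc))
          ¬bigc : ¬ Big c
          ¬bigc bigc = ¬steal (z , c , z∉near , bigc , c∉ , zc)
          two-c = [ (λ none → contradiction zc (none z)) , id ]′ (small ¬bigc)
          (z′ , z′≢z , z′c , _) = Two-other two-c zc
          z′∉ : z′ ∉ avoid
          z′∉ z′∈ = z∉partners (∈-bind z′∈ (∈-bind (∈-NA (sub z′c)) (∈-elements (cols c) zc)))
      in replace z∉near ¬bigc c∉ zc z′c z′≢z bigu u∉L zero-u (from (proj₂ bigu z′) (proj₂ (∉-++ near z′∉)))

  opaque

    repair : ∀ {H} → Good H → ∀ L → (∀ {y} → y ∈ L → EvenDegree (λ a → H a y)) → ∀ b → Repair H L b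
    repair {H} good L even b with em (EvenDegree (λ a → H a b))
    ... | yes ev = record { H′ = H ; good = good ; fixed = ev ; keeps = λ _ → ≐-refl }
    ... | no odd with Good.cols good b | em (Big b)
    ...   | inj₁ none       | _ = contradiction (inj₁ none) odd
    ...   | inj₂ (inj₂ two) | _ = contradiction (inj₂ two) odd
    ...   | _ | no ¬big = contradiction (Good.small good ¬big) odd
    ...   | inj₂ (inj₁ (x , xb , only)) | yes big = repair-one good L b (odd ∘ even) big xb only

  -- Convergence of the repairs

  done : ℕ → List B
  done zero    = []
  done (suc n) = proj₂ (edge n) ∷ done n

  ∈-done : ∀ {k n} → k < n → proj₂ (edge k) ∈ done n
  ∈-done {k} {suc n} k< with m≤n⇒m<n∨m≡n (s≤s⁻¹ k<)
  ... | inj₁ k<n  = there (∈-done k<n)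
  ... | inj₂ refl = here refl

  -- Vertices of `B` are treated in the order of the edge enumeration, which reaches all that have a
  -- neighbour. On a repeated vertex `repair` changes nothing.
  repaired : ∀ n → Σ[ H ∈ (A → B → Set) ] (Good H × (∀ {y} → y ∈ done n → EvenDegree (λ a → H a y)))
  next-repair : ∀ n → Repair (proj₁ (repaired n)) (done n) (proj₂ (edge n))

  next-repair n = let (_ , good , even) = repaired n in repair good (done n) even (proj₂ (edge n))

  repaired zero    = Limit , Limit-good , λ ()
  repaired (suc n) = H′ , good , λ { (here refl) → fixed ; (there y∈) → EvenDegree-resp (keeps y∈) (proj₂ (proj₂ (repaired n)) y∈) }
    where open Repair (next-repair n)

  Stage : ℕ → A → B → Set
  Stage n = proj₁ (repaired n)

  done-mono : ∀ k {n y} → y ∈ done n → y ∈ done (k + n)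
  done-mono zero    y∈ = y∈
  done-mono (suc k) y∈ = there (done-mono k y∈)

  stable : ∀ k {n y} → y ∈ done n → (λ a → Stage n a y) ≐ (λ a → Stage (k + n) a y)
  stable zero    y∈ = ≐-refl
  stable (suc k) {n} y∈ = ≐-trans (stable k y∈) (Repair.keeps (next-repair (k + n)) (done-mono k y∈))

  -- Both stages are compared with stage `m + n`, later than each of them.
  coherent : ∀ {m n y a} → y ∈ done m → y ∈ done n → Stage m a y → Stage n a y
  coherent {m} {n} {y} {a} y∈m y∈n h = proj₂ (stable m y∈n)
    (subst (λ k → Stage k a y) (+-comm n m) (proj₁ (stable n y∈m) h))

  -- The column of `b` is frozen once `b` is treated, and by `coherent` any later stage gives the
  -- same one.
  Final : A → B → Set
  Final a b = ∃[ n ] (b ∈ done n × Stage n a b)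

  Final-sub : ∀ {a b} → Final a b → E a b
  Final-sub (n , _ , h) = Good.sub (proj₁ (proj₂ (repaired n))) h

  Final-col : ∀ {n b} → b ∈ done n → (λ a → Stage n a b) ≐ (λ a → Final a b)
  Final-col {n} b∈ = (λ h → n , b∈ , h) , λ { (m , b∈m , h) → coherent b∈m b∈ h }

  Final-cols : ∀ b → EvenDegree (λ a → Final a b)
  Final-cols b with em (∃[ n ] b ∈ done n)
  ... | yes (n , b∈) = EvenDegree-resp (Final-col b∈) (proj₂ (proj₂ (repaired n)) b∈)
  ... | no never     = inj₁ λ { a (n , b∈ , _) → never (n , b∈) }

  -- Here finite degree enters: at some stage all neighbours of `a` have been treated, and from then
  -- on its row is final.
  Final-rows : ∀ a → Two (Final a)
  Final-rows a =
    let (n , index) = bounded {Q = λ b k → edge k ≡ (a , b)} (NA a) (edge-onto ∘ NA-∈)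
        all-done : ∀ {b} → E a b → b ∈ done n
        all-done e = let (k , k< , eq) = index (∈-NA e) in subst (_∈ done n) (cong proj₂ eq) (∈-done k<)
        good = proj₁ (proj₂ (repaired n))
    in Two-resp ((λ h → n , all-done (Good.sub good h) , h)
                , λ { f@(m , b∈ , h) → coherent b∈ (all-done (Final-sub f)) h })
         (Good.rows good a)

theorem2p11 : ExcludedMiddle →
  (A B : Set) (E : A → B → Set) →
  Infinite A → Infinite B →
  Bipartite.dHp E →
  (∀ a → Finite (λ b → E a b)) →
  (∀ b → Finite (λ a → E a b) ⊎ Σ[ F ∈ List A ] (∀ a → E a b ⇔ (a ∉ F))) →
  Σ[ I ∈ Set ] Σ[ H ∈ (I → Bipartite.Subgraph E) ]
    ((∀ i → Bipartite.TwoRegular E (H i))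
    × (∀ i j → i ≢ j → (∀ a → ¬ (Bipartite.Subgraph.VA (H i) a × Bipartite.Subgraph.VA (H j) a))
                      × (∀ b → ¬ (Bipartite.Subgraph.VB (H i) b × Bipartite.Subgraph.VB (H j) b)))
    × (∀ a → Σ[ i ∈ I ] Bipartite.Subgraph.VA (H i) a))
theorem2p11 em A B E infA _ dhp finite finite-or-cofinite =
  -- A family with one member suffices: the cycles and double rays are the components of `H`, which
  -- omits the vertices of `B` of degree 0.
  ⊤ , (λ _ → H) , (λ _ → (λ a _ → Final-rows a) , λ { b (a , ab) → [ (λ none → contradiction ab (none a)) , id ]′ (Final-cols b) }) ,
  (λ _ _ i≢j → contradiction refl i≢j) , λ a → tt , tt
  where
  open DoubleHall em E infA dhp finite finite-or-cofinite
  H : Bipartite.Subgraph E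
  H = record
    { VA = λ _ → ⊤ ; VB = λ b → ∃[ a ] Final a b ; EH = Final
    ; EH⊆E = λ _ _ → Final-sub ; EH-endsA = λ _ _ _ → tt ; EH-endsB = λ a _ ab → a , ab }
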